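{- Let $G$ be a finite simple graph that is triangle-free, $4$-sunspot-free, and $t$-sun-free for all integers $t\geq 5$. Then $\chi(G)\leq 47$.
   Context: Graphs are finite, without loops or parallel edges; $\chi(G)$ is the chromatic number. For an integer $t\geq 4$, a $t$-sun is the graph obtained from a $t$-vertex cycle by adding, for each vertex of the cycle, a new vertex of degree one adjacent to it. A $t$-sunspot is the graph obtained from a $t$-sun by deleting a single degree-one vertex. A graph is $t$-sun-free (resp. $t$-sunspot-free) if no induced subgraph of it is isomorphic to a $t$-sun (resp. $t$-sunspot). -}

module Defs where

open import Data.Nat using (ℕ; suc; _∸_; _≡ᵇ_; _≤_)
open import Data.Fin using (Fin; toℕ)
open import Data.Bool using (Bool; true; false; _∨_; _∧_)
open import Data.Sum using (_⊎_; inj₁; inj₂)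
open import Data.Product using (Σ; _×_)
open import Relation.Binary.PropositionalEquality using (_≡_)
open import Relation.Nullary using (¬_)
open import Data.Empty using (⊥)
open import Function.Definitions using (Injective)

record Graph (n : ℕ) : Set where
  field
    adj   : Fin n → Fin n → Bool
    sym   : ∀ u v → adj u v ≡ adj v u
    irrefl : ∀ v → adj v v ≡ false
open Graph public

ContainsInduced : {n : ℕ} {V : Set} → (V → V → Bool) → Graph n → Set
ContainsInduced {n} {V} H G =
  Σ (V → Fin n) λ f → Injective _≡_ _≡_ f × (∀ x y → adj G (f x) (f y) ≡ H x y)

cycStep : (t : ℕ) → Fin t → Fin t → Bool
cycStep t i j = (toℕ j ≡ᵇ suc (toℕ i)) ∨ ((toℕ i ≡ᵇ (t ∸ 1)) ∧ (toℕ j ≡ᵇ 0))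

cycAdj : (t : ℕ) → Fin t → Fin t → Bool
cycAdj t i j = cycStep t i j ∨ cycStep t j i

sunAdj : (t : ℕ) → (Fin t ⊎ Fin t) → (Fin t ⊎ Fin t) → Bool
sunAdj t (inj₁ i) (inj₁ j) = cycAdj t i j
sunAdj t (inj₁ i) (inj₂ j) = toℕ i ≡ᵇ toℕ j
sunAdj t (inj₂ i) (inj₁ j) = toℕ i ≡ᵇ toℕ j
sunAdj t (inj₂ i) (inj₂ j) = false

-- the t-sunspot: the t-sun with the pendant vertex of the last cycle vertex
-- (index t-1) deleted; pendants inj₂ j (j < t-1) attached to inj₁ j.
sunspotAdj : (t : ℕ) → (Fin t ⊎ Fin (t ∸ 1)) → (Fin t ⊎ Fin (t ∸ 1)) → Bool
sunspotAdj t (inj₁ i) (inj₁ j) = cycAdj t i j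
sunspotAdj t (inj₁ i) (inj₂ j) = toℕ i ≡ᵇ toℕ j
sunspotAdj t (inj₂ i) (inj₁ j) = toℕ i ≡ᵇ toℕ j
sunspotAdj t (inj₂ i) (inj₂ j) = false

SunFree : (t : ℕ) → {n : ℕ} → Graph n → Set
SunFree t G = ¬ ContainsInduced (sunAdj t) G

SunspotFree : (t : ℕ) → {n : ℕ} → Graph n → Set
SunspotFree t G = ¬ ContainsInduced (sunspotAdj t) G

TriangleFree : {n : ℕ} → Graph n → Set
TriangleFree G = ∀ u v w → adj G u v ≡ true → adj G v w ≡ true → adj G u w ≡ true → ⊥

ProperColouring : {n : ℕ} → Graph n → (k : ℕ) → (Fin n → Fin k) → Set
ProperColouring G k c = ∀ u v → adj G u v ≡ true → ¬ (c u ≡ c v)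

ChromaticAtMost : {n : ℕ} → Graph n → ℕ → Set
ChromaticAtMost {n} G k = Σ (Fin n → Fin k) (ProperColouring G k)

{-# OPTIONS --safe #-}
module Submission where

-- Let G be a minimal counterexample. Then G has large degrees, no neighbourhood contains another one, and no union of
-- components can be coloured separately. Hence any three vertices include w, w′ with nonadjacent y ∈ N(w) \ N(w′) and
-- y′ ∈ N(w′) \ N(w), which together with sunspot-freeness makes common neighbourhoods small.
--
-- Take a shortest odd closed walk C. Vertices outside C have one neighbour on C or two at distance 2 (clones of a vertex
-- of C). If some vertex off N(C) is adjacent to N(C) but to no clone, then C has no clones near it, the neighbours off C of
-- consecutive vertices are anticomplete to each other, and this propagates around C; pendants chosen greedily then give a sun.
-- Otherwise, if |C| > 5, N(C) is closed under adjacency, and N(C) splits into 5 stable sets. If |C| = 5, the vertices at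
-- distance at most 2 from C are closed under adjacency, and the further ones, being adjacent to clones, are covered by
-- three stable sets for each vertex of C. Either way this set can be coloured with at most 20 colours.

open import Defs
open import Data.Bool using (Bool; true; false; not; _xor_; T)
import Data.Bool.Properties as Bool
open import Data.Nat as ℕ using (ℕ; zero; suc; _+_; _∸_; _*_; _≤_; _<_; z≤n; s≤s; _≡ᵇ_; NonZero; >-nonZero)
open import Data.Nat.DivMod using (_%_; _/_; m≡m%n+[m/n]*n; m%n<n)
open import Data.Nat.Induction using (<-rec)
open import Data.Nat.Properties as ℕₚ
  using (≤-trans; +-mono-≤; ≤ᵇ⇒≤; ≤-reflexive; +-comm; +-assoc; +-suc; +-identityʳ; ≤-antisym;
         +-cancelˡ-≤; +-cancelʳ-≤; m+[n∸m]≡n; m+n∸m≡n; <-cmp)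
open import Data.Fin using (Fin; zero; suc; toℕ; fromℕ<; punchIn; punchOut; inject≤; splitAt; join)
open import Data.Fin.Properties as Finₚ
  using (any?; all?; _≟_; toℕ-injective; toℕ<n; toℕ-fromℕ<; pigeonhole; punchIn-injective; punchIn-punchOut;
         inject≤-injective; sequence; splitAt-join)
open import Data.List using (List; []; _∷_; length; lookup; map; _++_; concatMap; allFin)
open import Data.List.Properties using (length-map; length-++)
open import Data.List.Membership.Propositional using (_∈_; _∉_)
import Data.List.Membership.DecPropositional as DecMembership
open import Data.List.Membership.Propositional.Properties using (∈-allFin; ∈-map⁺; ∈-++⁺ˡ; ∈-++⁺ʳ)
open import Data.List.Relation.Unary.Any as Any using (Any; here; there; index)
open import Data.List.Relation.Unary.Any.Properties using (lookup-index; concatMap⁺; ++⁺ˡ; ++⁺ʳ)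
open import Data.Product using (Σ; ∃; ∃₂; _×_; _,_; proj₁; proj₂)
open import Data.Sum as Sum using (_⊎_; inj₁; inj₂; [_,_])
open import Data.Empty using (⊥; ⊥-elim)
open import Data.Unit using (tt)
import Data.Vec.Functional as Vector
open import Effect.Monad using (RawMonad)
open import Function using (_∘_; id)
open import Function.Bundles using (module Equivalence)
open import Relation.Nullary using (¬_; Dec; yes; no)
open import Relation.Nullary.Negation using (¬¬-Monad)
open import Relation.Nullary.Decidable
  using (toWitness; decidable-stable; ¬?; _×-dec_; _→-dec_; _⊎-dec_; map′; ¬¬-excluded-middle)
open import Relation.Binary.Definitions using (tri<; tri≈; tri>)
open import Relation.Unary using (Decidable)
open import Relation.Binary.PropositionalEquality
  using (_≡_; _≢_; _≗_; refl; trans; cong; subst; subst₂) renaming (sym to ≡-sym)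

-- Sets of at most two vertices, and the 4-sunspot.

AtMostTwo : {A : Set} → (A → Set) → Set
AtMostTwo P = ∀ x y z → P x → P y → P z → x ≢ y → x ≢ z → y ≢ z → ⊥

AtMostTwo⇒list : ∀ {n} {P : Fin n → Set} → Decidable P → AtMostTwo P →
  Σ (List (Fin n)) λ xs → length xs ≤ 2 × (∀ v → P v → v ∈ xs)
AtMostTwo⇒list {n} {P} P? atMost with any? P?
... | no none = [] , z≤n , λ v Pv → ⊥-elim (none (v , Pv))
... | yes (x , Px) with any? (λ y → P? y ×-dec ¬? (x ≟ y))
...   | no single = x ∷ [] , s≤s z≤n , member
  where
  member : ∀ v → P v → v ∈ x ∷ []
  member v Pv with x ≟ v
  ... | yes x≡v = here (≡-sym x≡v)
  ... | no x≢v = ⊥-elim (single (v , Pv , x≢v))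
...   | yes (y , Py , x≢y) = x ∷ y ∷ [] , s≤s (s≤s z≤n) , member
  where
  member : ∀ v → P v → v ∈ x ∷ y ∷ []
  member v Pv with x ≟ v | y ≟ v
  ... | yes x≡v | _ = here (≡-sym x≡v)
  ... | no _ | yes y≡v = there (here (≡-sym y≡v))
  ... | no x≢v | no y≢v = ⊥-elim (atMost x y v Px Py Pv x≢y x≢v y≢v)

private
  slot : Fin 7 → Fin 4 ⊎ Fin 3
  slot = splitAt 4

-- Makes every adjacency-preserving map from the 4-sunspot injective, so that `spot` asks for no
-- inequalities. Checked by evaluation on the seven vertices.
sunspot-rows-distinct : ∀ x y → (∀ z → sunspotAdj 4 x z ≡ sunspotAdj 4 y z) → x ≡ y
sunspot-rows-distinct x y eq =
  trans (≡-sym (splitAt-join 4 3 x)) (trans (cong slot (distinct (join 4 3 x) (join 4 3 y) eq′)) (splitAt-join 4 3 y))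
  where
  distinct : ∀ i j → (∀ k → sunspotAdj 4 (slot i) (slot k) ≡ sunspotAdj 4 (slot j) (slot k)) → i ≡ j
  distinct = toWitness {a? = all? λ i → all? λ j →
    all? (λ k → sunspotAdj 4 (slot i) (slot k) Bool.≟ sunspotAdj 4 (slot j) (slot k)) →-dec (i ≟ j)} _
  eq′ : ∀ k → sunspotAdj 4 (slot (join 4 3 x)) (slot k) ≡ sunspotAdj 4 (slot (join 4 3 y)) (slot k)
  eq′ k rewrite splitAt-join 4 3 x | splitAt-join 4 3 y = eq (slot k)

-- Adjacency, unions of components, and critical graphs.

module Adjacency {n : ℕ} (G : Graph n) where

  V : Set
  V = Fin n

  infix 4 _~_ _~?_

  data _~_ (u v : V) : Set where
    edge : adj G u v ≡ true → u ~ v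

  adjacent : ∀ {u v} → u ~ v → adj G u v ≡ true
  adjacent (edge eq) = eq

  _~?_ : ∀ u v → Dec (u ~ v)
  u ~? v = map′ edge adjacent (adj G u v Bool.≟ true)

  ~-sym : ∀ {u v} → u ~ v → v ~ u
  ~-sym {u} {v} (edge eq) = edge (trans (Graph.sym G v u) eq)

  ~-irrefl : ∀ {u} → ¬ u ~ u
  ~-irrefl {u} (edge eq) with trans (≡-sym eq) (irrefl G u)
  ... | ()

  ~⇒≢ : ∀ {u v} → u ~ v → u ≢ v
  ~⇒≢ u~v refl = ~-irrefl u~v

  ~-stable : ∀ {u v} → ¬ ¬ u ~ v → u ~ v
  ~-stable {u} {v} = decidable-stable (u ~? v)

  ≢-separated : ∀ {u v w} → u ~ w → ¬ v ~ w → u ≢ v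
  ≢-separated u~w v≁w refl = v≁w u~w

  Closed : (V → Set) → Set
  Closed K = ∀ {u v} → u ~ v → K u → K v

  record StableSet : Set₁ where
    field
      member : V → Set
      stable : ∀ {u v} → member u → member v → ¬ u ~ v

  -- A nonempty union of connected components. The classes may overlap: the one picked by `covered`
  -- will serve as the colour of a vertex.
  record Component : Set₁ where
    field
      member : V → Set
      member? : Decidable member
      closed : Closed member
      root : V
      root∈ : member root
      classes : List StableSet
      few : length classes ≤ 47
      covered : ∀ {v} → member v → Any (λ S → StableSet.member S v) classes

  NotDominated : Set
  NotDominated = ∀ {u v} → u ≢ v → ∃ λ w → w ~ u × ¬ w ~ v

  -- The properties of a minimal counterexample that are used until suns enter. `largeDegree` means
  -- that all degrees are at least 47, phrased for choosing a neighbour outside a short list.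
  record Critical : Set where
    field
      triangleFree : TriangleFree G
      sunspotFree : SunspotFree 4 G
      notDominated : NotDominated
      largeDegree : ∀ v (xs : List V) → length xs ≤ 46 → ∃ λ u → u ~ v × u ∉ xs

-- Sunspots and crossing pairs in triangle-free graphs.

module TriangleFreeGraph {n : ℕ} (G : Graph n) (triangleFree : TriangleFree G) where

  open Adjacency G public

  tri : ∀ {u v w} → u ~ v → v ~ w → u ~ w → ⊥
  tri {u} {v} {w} (edge e) (edge f) (edge g) = triangleFree u v w e f g

  tri′ : ∀ {u v w} → v ~ u → w ~ u → ¬ v ~ w
  tri′ v~u w~u v~w = tri v~w w~u v~u

  module _ (sunspotFree : SunspotFree 4 G) where

    -- Consecutive vertices of the 4-cycle and a vertex and its pendant have no
    -- common neighbour, so only the listed non-adjacencies need to be supplied.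
    spot : ∀ {a b c d p q r} → a ~ b → b ~ c → c ~ d → d ~ a → p ~ a → q ~ b → r ~ c →
      ¬ p ~ c → ¬ q ~ d → ¬ r ~ a → ¬ p ~ q → ¬ q ~ r → ¬ p ~ r → ⊥
    spot {a} {b} {c} {d} {p} {q} {r} a~b b~c c~d d~a p~a q~b r~c p≁c q≁d r≁a p≁q q≁r p≁r =
      sunspotFree (place , injective , adjacency)
      where
      place : Fin 4 ⊎ Fin 3 → V
      place (inj₁ zero) = a
      place (inj₁ (suc zero)) = b
      place (inj₁ (suc (suc zero))) = c
      place (inj₁ (suc (suc (suc zero)))) = d
      place (inj₂ zero) = p
      place (inj₂ (suc zero)) = q
      place (inj₂ (suc (suc zero))) = r

      no~ : ∀ {u v} → ¬ u ~ v → adj G u v ≡ false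
      no~ u≁v = Bool.¬-not (u≁v ∘ edge)

      sy : ∀ {u v x} → adj G u v ≡ x → adj G v u ≡ x
      sy {u} {v} = trans (Graph.sym G v u)

      a≁c : adj G a c ≡ false
      a≁c = no~ (tri′ a~b (~-sym b~c))
      b≁d : adj G b d ≡ false
      b≁d = no~ (tri′ b~c (~-sym c~d))
      p≁b : adj G p b ≡ false
      p≁b = no~ (tri′ p~a (~-sym a~b))
      p≁d : adj G p d ≡ false
      p≁d = no~ (tri′ p~a d~a)
      q≁a : adj G q a ≡ false
      q≁a = no~ (tri′ q~b a~b)
      q≁c : adj G q c ≡ false
      q≁c = no~ (tri′ q~b (~-sym b~c))
      r≁b : adj G r b ≡ false
      r≁b = no~ (tri′ r~c b~c)
      r≁d : adj G r d ≡ false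
      r≁d = no~ (tri′ r~c (~-sym c~d))

      cases₄ : {P : Fin 4 → Set} → P zero → P (suc zero) → P (suc (suc zero)) → P (suc (suc (suc zero))) → ∀ i → P i
      cases₄ w x y z zero = w
      cases₄ w x y z (suc zero) = x
      cases₄ w x y z (suc (suc zero)) = y
      cases₄ w x y z (suc (suc (suc zero))) = z

      cases₃ : {P : Fin 3 → Set} → P zero → P (suc zero) → P (suc (suc zero)) → ∀ i → P i
      cases₃ w x y zero = w
      cases₃ w x y (suc zero) = x
      cases₃ w x y (suc (suc zero)) = y

      adjacency : ∀ x y → adj G (place x) (place y) ≡ sunspotAdj 4 x y
      adjacency (inj₁ i) (inj₁ j) = cases₄ {λ i → ∀ j → adj G (place (inj₁ i)) (place (inj₁ j)) ≡ cycAdj 4 i j}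
        (cases₄ (irrefl G a) (adjacent a~b) a≁c (sy (adjacent d~a)))
        (cases₄ (sy (adjacent a~b)) (irrefl G b) (adjacent b~c) b≁d)
        (cases₄ (sy a≁c) (sy (adjacent b~c)) (irrefl G c) (adjacent c~d))
        (cases₄ (adjacent d~a) (sy b≁d) (sy (adjacent c~d)) (irrefl G d)) i j
      adjacency (inj₁ i) (inj₂ j) = cases₄ {λ i → ∀ j → adj G (place (inj₁ i)) (place (inj₂ j)) ≡ (toℕ i ≡ᵇ toℕ j)}
        (cases₃ (sy (adjacent p~a)) (sy q≁a) (sy (no~ r≁a)))
        (cases₃ (sy p≁b) (sy (adjacent q~b)) (sy r≁b))
        (cases₃ (sy (no~ p≁c)) (sy q≁c) (sy (adjacent r~c)))
        (cases₃ (sy p≁d) (sy (no~ q≁d)) (sy r≁d)) i j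
      adjacency (inj₂ i) (inj₁ j) = cases₃ {λ i → ∀ j → adj G (place (inj₂ i)) (place (inj₁ j)) ≡ (toℕ i ≡ᵇ toℕ j)}
        (cases₄ (adjacent p~a) p≁b (no~ p≁c) p≁d)
        (cases₄ q≁a (adjacent q~b) q≁c (no~ q≁d))
        (cases₄ (no~ r≁a) r≁b (adjacent r~c) r≁d) i j
      adjacency (inj₂ i) (inj₂ j) = cases₃ {λ i → ∀ j → adj G (place (inj₂ i)) (place (inj₂ j)) ≡ false}
        (cases₃ (irrefl G p) (no~ p≁q) (no~ p≁r))
        (cases₃ (sy (no~ p≁q)) (irrefl G q) (no~ q≁r))
        (cases₃ (sy (no~ p≁r)) (sy (no~ q≁r)) (irrefl G r)) i j

      injective : ∀ {x y} → place x ≡ place y → x ≡ y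
      injective {x} {y} eq = sunspot-rows-distinct x y λ z →
        trans (≡-sym (adjacency x z)) (trans (cong (λ v → adj G v (place z)) eq) (adjacency y z))

  module _ (notDominated : NotDominated) where

    Crossing : V → V → V → V → Set
    Crossing w w′ y y′ = (y ~ w × ¬ y ~ w′) × (y′ ~ w′ × ¬ y′ ~ w)

    private
      NoCrossing : V → V → Set
      NoCrossing w w′ = ∀ {y y′} → Crossing w w′ y y′ → y ~ y′

      flip-crossing : ∀ {w w′} → NoCrossing w w′ → NoCrossing w′ w
      flip-crossing h (yc , yc′) = ~-sym (h (yc′ , yc))

      -- If each neighbour of y is adjacent to x or z, then a neighbour e of y missing z and a
      -- neighbour g of y missing x cross x and z. So e ~ g, a triangle with y.
      no-outlier : ∀ {x y z} → y ≢ x → y ≢ z → NoCrossing x z → ¬ (∃ λ g → g ~ y × ¬ g ~ x × ¬ g ~ z) → ⊥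
      no-outlier {x} {y} {z} y≢x y≢z xz inside with notDominated y≢z | notDominated y≢x
      ... | e , e~y , e≁z | g , g~y , g≁x = tri′ e~y g~y (xz ((e~x , e≁z) , (g~z , g≁x)))
        where
        e~x : e ~ x
        e~x = ~-stable λ e≁x → inside (e , e~y , e≁x , e≁z)
        g~z : g ~ z
        g~z = ~-stable λ g≁z → inside (g , g~y , g≁x , g≁z)

      outlier? : ∀ x y z → Dec (∃ λ g → g ~ y × ¬ g ~ x × ¬ g ~ z)
      outlier? x y z = any? λ g → (g ~? y) ×-dec ¬? (g ~? x) ×-dec ¬? (g ~? z)

      -- If y and z also have neighbours missing the other two vertices, the three private
      -- neighbours are pairwise adjacent. Otherwise `no-outlier` applies to y or z.
      no-private-neighbour : ∀ {x y z v} → x ≢ y → x ≢ z → y ≢ z →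
        NoCrossing x y → NoCrossing x z → NoCrossing y z → v ~ x → ¬ v ~ y → ¬ v ~ z → ⊥
      no-private-neighbour {x} {y} {z} x≢y x≢z y≢z xy xz yz v~x v≁y v≁z with outlier? x y z | outlier? x z y
      ... | no inside | _ = no-outlier (x≢y ∘ ≡-sym) y≢z xz inside
      ... | yes _ | no inside = no-outlier (x≢z ∘ ≡-sym) (y≢z ∘ ≡-sym) xy inside
      ... | yes (g , g~y , g≁x , g≁z) | yes (h , h~z , h≁x , h≁y) =
        tri (xy ((v~x , v≁y) , (g~y , g≁x))) (yz ((g~y , g≁z) , (h~z , h≁y))) (xz ((v~x , v≁z) , (h~z , h≁x)))

    -- The source of all bounds on common neighbourhoods. For members x, y, z take a in N(x) minus
    -- N(y) and b in N(y) minus N(x). As a ~ b, one of them misses z, and it is a private neighbour.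
    complete-crossings⇒AtMostTwo : ∀ {P : V → Set} → (∀ {w w′ y y′} → P w → P w′ → Crossing w w′ y y′ → y ~ y′) → AtMostTwo P
    complete-crossings⇒AtMostTwo cross x y z Px Py Pz x≢y x≢z y≢z with notDominated x≢y | notDominated (x≢y ∘ ≡-sym)
    ... | a , a~x , a≁y | b , b~y , b≁x with a ~? z | b ~? z
    ... | yes a~z | yes b~z = tri′ a~z b~z (cross Px Py ((a~x , a≁y) , (b~y , b≁x)))
    ... | no a≁z | _ = no-private-neighbour x≢y x≢z y≢z (cross Px Py) (cross Px Pz) (cross Py Pz) a~x a≁y a≁z
    ... | yes _ | no b≁z = no-private-neighbour (x≢y ∘ ≡-sym) y≢z x≢z
      (flip-crossing (cross Px Py)) (cross Py Pz) (cross Px Pz) b~y b≁x b≁z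

-- Local analysis of a shortest odd closed walk in a critical graph.

module CriticalGraph {n : ℕ} (G : Graph n) (critical : Adjacency.Critical G) where

  open Adjacency.Critical critical
  open TriangleFreeGraph G triangleFree public hiding (spot; Crossing; complete-crossings⇒AtMostTwo)

  spot : ∀ {a b c d p q r} → a ~ b → b ~ c → c ~ d → d ~ a → p ~ a → q ~ b → r ~ c →
    ¬ p ~ c → ¬ q ~ d → ¬ r ~ a → ¬ p ~ q → ¬ q ~ r → ¬ p ~ r → ⊥
  spot = TriangleFreeGraph.spot G triangleFree sunspotFree

  Crossing : V → V → V → V → Set
  Crossing = TriangleFreeGraph.Crossing G triangleFree notDominated

  complete-crossings⇒AtMostTwo : ∀ {P : V → Set} →
    (∀ {w w′ y y′} → P w → P w′ → Crossing w w′ y y′ → y ~ y′) → AtMostTwo P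
  complete-crossings⇒AtMostTwo = TriangleFreeGraph.complete-crossings⇒AtMostTwo G triangleFree notDominated

  -- At most six neighbours of v are excluded, fewer than its degree.
  avoid : ∀ {P Q : V → Set} → Decidable P → Decidable Q → AtMostTwo P → AtMostTwo Q →
    ∀ v x y → ∃ λ u → u ~ v × ¬ P u × ¬ Q u × u ≢ x × u ≢ y
  avoid P? Q? P≤2 Q≤2 v x y with AtMostTwo⇒list P? P≤2 | AtMostTwo⇒list Q? Q≤2
  ... | ps , |ps|≤2 , P⊆ps | qs , |qs|≤2 , Q⊆qs with largeDegree v (x ∷ y ∷ ps ++ qs) bound
    where
    bound : length (x ∷ y ∷ ps ++ qs) ≤ 46
    bound = ≤-trans (s≤s (s≤s (≤-trans (≤-reflexive (length-++ ps)) (+-mono-≤ |ps|≤2 |qs|≤2)))) (≤ᵇ⇒≤ 6 46 _)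
  ...   | u , u~v , u∉ = u , u~v , (λ Pu → u∉ (there (there (∈-++⁺ˡ (P⊆ps u Pu))))) ,
          (λ Qu → u∉ (there (there (∈-++⁺ʳ ps (Q⊆qs u Qu))))) , (λ { refl → u∉ (here refl) }) , λ { refl → u∉ (there (here refl)) }

  avoid₁ : ∀ {P : V → Set} → Decidable P → AtMostTwo P → ∀ v x y → ∃ λ u → u ~ v × ¬ P u × u ≢ x × u ≢ y
  avoid₁ P? P≤2 v x y with avoid P? P? P≤2 P≤2 v x y
  ... | u , u~v , ¬Pu , _ , u≢x , u≢y = u , u~v , ¬Pu , u≢x , u≢y

  -- For consecutive x, m, y of a walk: no vertex other than m can replace m.
  NoClone : V → V → V → Set
  NoClone x m y = ∀ {d} → d ~ x → d ~ y → d ≡ m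

  -- Seven consecutive vertices of a shortest odd closed walk; Five says that its
  -- length is 5, and then the seven vertices wrap around.
  module Windows (Five : Set) (pentagon : ∀ {a b c d e} → a ~ b → b ~ c → c ~ d → d ~ e → e ~ a → Five) where

    record Window : Set where
      field
        l₃ l₂ l₁ o r₁ r₂ r₃ : V
        l₃~l₂ : l₃ ~ l₂
        l₂~l₁ : l₂ ~ l₁
        l₁~o : l₁ ~ o
        o~r₁ : o ~ r₁
        r₁~r₂ : r₁ ~ r₂
        r₂~r₃ : r₂ ~ r₃
        l₃≁o : ¬ l₃ ~ o
        l₂≁r₁ : ¬ l₂ ~ r₁
        l₁≁r₂ : ¬ l₁ ~ r₂
        o≁r₃ : ¬ o ~ r₃
        apart-l₃r₁ : ∀ {v} → v ~ l₃ → ¬ v ~ r₁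
        apart-l₂r₂ : ∀ {v} → v ~ l₂ → ¬ v ~ r₂
        apart-l₁r₃ : ∀ {v} → v ~ l₁ → ¬ v ~ r₃
        wrap-l : Five → l₃ ≡ r₂
        wrap-r : Five → r₃ ≡ l₂

    mirror : Window → Window
    mirror w = record
      { l₃ = r₃ ; l₂ = r₂ ; l₁ = r₁ ; o = o ; r₁ = l₁ ; r₂ = l₂ ; r₃ = l₃
      ; l₃~l₂ = ~-sym r₂~r₃ ; l₂~l₁ = ~-sym r₁~r₂ ; l₁~o = ~-sym o~r₁
      ; o~r₁ = ~-sym l₁~o ; r₁~r₂ = ~-sym l₂~l₁ ; r₂~r₃ = ~-sym l₃~l₂
      ; l₃≁o = o≁r₃ ∘ ~-sym ; l₂≁r₁ = l₁≁r₂ ∘ ~-sym ; l₁≁r₂ = l₂≁r₁ ∘ ~-sym ; o≁r₃ = l₃≁o ∘ ~-sym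
      ; apart-l₃r₁ = λ a b → apart-l₁r₃ b a ; apart-l₂r₂ = λ a b → apart-l₂r₂ b a ; apart-l₁r₃ = λ a b → apart-l₃r₁ b a
      ; wrap-l = wrap-r ; wrap-r = wrap-l }
      where open Window w

    -- z has no neighbour in the walk (take d on the walk) and no neighbour that is a clone of a vertex of the walk.
    record Remote (w : Window) (z : V) : Set where
      open Window w
      field
        off-l₂ : ∀ {d} → d ~ l₃ → d ~ l₁ → ¬ z ~ d
        off-l₁ : ∀ {d} → d ~ l₂ → d ~ o → ¬ z ~ d
        off-o : ∀ {d} → d ~ l₁ → d ~ r₁ → ¬ z ~ d
        off-r₁ : ∀ {d} → d ~ o → d ~ r₂ → ¬ z ~ d
        off-r₂ : ∀ {d} → d ~ r₁ → d ~ r₃ → ¬ z ~ d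

    mirror-remote : ∀ {w z} → Remote w z → Remote (mirror w) z
    mirror-remote rem = record
      { off-l₂ = λ a b → off-r₂ b a ; off-l₁ = λ a b → off-r₁ b a ; off-o = λ a b → off-o b a
      ; off-r₁ = λ a b → off-l₁ b a ; off-r₂ = λ a b → off-l₂ b a }
      where open Remote rem

    -- A candidate for the pendant at o. By `only-l` and `only-r` it is anticomplete to the
    -- neighbours of l₁ and r₁ other than o.
    record Good (w : Window) (p : V) : Set where
      open Window w
      field
        p~o : p ~ o
        p≁l₂ : ¬ p ~ l₂
        p≁r₂ : ¬ p ~ r₂
        only-l : ∀ {g} → g ~ p → g ~ l₁ → g ≡ o
        only-r : ∀ {g} → g ~ p → g ~ r₁ → g ≡ o

    mirror-good : ∀ {w p} → Good w p → Good (mirror w) p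
    mirror-good good = record { p~o = p~o ; p≁l₂ = p≁r₂ ; p≁r₂ = p≁l₂ ; only-l = only-r ; only-r = only-l }
      where open Good good

    -- If g ≢ o, a sunspot on p, o, r₁, g gives g ~ l₁. A vertex y adjacent to just one of o and g
    -- is then adjacent to z, as otherwise sunspots make it adjacent to both l₂ and r₂. So
    -- separators y and y′ of o and g are nonadjacent, and sunspots through both make y′ adjacent to
    -- l₂ and r₂, which have no common neighbour.
    remote⇒only-r : ∀ w → let open Window w in ∀ {z p g} → Remote w z → z ~ p → p ~ o → g ~ p → g ~ r₁ → g ≡ o
    remote⇒only-r w {z} {p} {g} rem z~p p~o g~p g~r₁ = decidable-stable (g ≟ o) λ g≢o → contradict g≢o
      where
      open Window w
      open Remote rem
      z≁l₁ : ¬ z ~ l₁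
      z≁l₁ = off-l₁ (~-sym l₂~l₁) l₁~o
      z≁l₂ : ¬ z ~ l₂
      z≁l₂ = off-l₂ (~-sym l₃~l₂) l₂~l₁
      z≁r₁ : ¬ z ~ r₁
      z≁r₁ = off-r₁ (~-sym o~r₁) r₁~r₂
      z≁r₂ : ¬ z ~ r₂
      z≁r₂ = off-r₂ (~-sym r₁~r₂) r₂~r₃
      p≁r₂ : ¬ p ~ r₂
      p≁r₂ p~r₂ = off-r₁ p~o p~r₂ z~p
      p≁l₂ : ¬ p ~ l₂
      p≁l₂ p~l₂ = off-l₁ p~l₂ p~o z~p
      module _ (g≢o : g ≢ o) where
        g~l₁ : g ~ l₁
        g~l₁ = ~-stable λ g≁l₁ → spot p~o o~r₁ (~-sym g~r₁) g~p z~p l₁~o (~-sym r₁~r₂)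
          z≁r₁ (g≁l₁ ∘ ~-sym) (p≁r₂ ∘ ~-sym) z≁l₁ l₁≁r₂ z≁r₂
        on-z : ∀ {a b y} → p ~ a → a ~ r₁ → b ~ r₁ → b ~ p → a ~ l₁ → b ~ l₁ → y ~ a → ¬ y ~ b → y ~ z
        on-z p~a a~r₁ b~r₁ b~p a~l₁ b~l₁ y~a y≁b = ~-stable λ y≁z → apart-l₂r₂
          (~-stable λ y≁l₂ → spot p~a a~l₁ (~-sym b~l₁) b~p z~p y~a l₂~l₁ z≁l₁ y≁b (p≁l₂ ∘ ~-sym) (y≁z ∘ ~-sym) y≁l₂ z≁l₂)
          (~-stable λ y≁r₂ → spot p~a a~r₁ (~-sym b~r₁) b~p z~p y~a (~-sym r₁~r₂) z≁r₁ y≁b (p≁r₂ ∘ ~-sym) (y≁z ∘ ~-sym) y≁r₂ z≁r₂)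
        contradict : ⊥
        contradict with notDominated g≢o | notDominated (g≢o ∘ ≡-sym)
        ... | y′ , y′~g , y′≁o | y , y~o , y≁g = apart-l₂r₂ y′~l₂ y′~r₂
          where
          y~z : y ~ z
          y~z = on-z p~o o~r₁ g~r₁ g~p (~-sym l₁~o) g~l₁ y~o y≁g
          y′~z : y′ ~ z
          y′~z = on-z (~-sym g~p) g~r₁ o~r₁ (~-sym p~o) g~l₁ (~-sym l₁~o) y′~g y′≁o
          y≁y′ : ¬ y ~ y′
          y≁y′ = tri′ y~z y′~z
          y′~r₂ : y′ ~ r₂
          y′~r₂ = ~-stable λ y′≁r₂ → spot o~r₁ (~-sym g~r₁) g~p p~o y~o (~-sym r₁~r₂) y′~g
            y≁g (p≁r₂ ∘ ~-sym) y′≁o (λ y~r₂ → off-r₁ y~o y~r₂ (~-sym y~z)) (y′≁r₂ ∘ ~-sym) y≁y′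
          y′~l₂ : y′ ~ l₂
          y′~l₂ = ~-stable λ y′≁l₂ → spot (~-sym l₁~o) (~-sym g~l₁) g~p p~o y~o l₂~l₁ y′~g
            y≁g (p≁l₂ ∘ ~-sym) y′≁o (λ y~l₂ → off-l₁ y~l₂ y~o (~-sym y~z)) (y′≁l₂ ∘ ~-sym) y≁y′

    remote⇒good : ∀ w → let open Window w in ∀ {z p} → Remote w z → z ~ p → p ~ o → Good w p
    remote⇒good w rem z~p p~o = record
      { p~o = p~o
      ; p≁l₂ = λ p~l₂ → Remote.off-l₁ rem p~l₂ p~o z~p
      ; p≁r₂ = λ p~r₂ → Remote.off-r₁ rem p~o p~r₂ z~p
      ; only-l = remote⇒only-r (mirror w) (mirror-remote rem) z~p p~o
      ; only-r = remote⇒only-r w rem z~p p~o }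

    -- Conditional on `Five`, so that it holds vacuously on longer cycles, where goodness has to
    -- pass to vertices without a known remote neighbour.
    Witness : Window → V → Set
    Witness w p = Five → ∃ λ z → z ~ p × Remote w z

    mirror-witness : ∀ {w p} → Witness w p → Witness (mirror w) p
    mirror-witness wit five with wit five
    ... | z , z~p , rem = z , z~p , mirror-remote rem

    -- If y and y′ separate r₁ from a clone d, sunspots on o, r₁, r₂, d give y ~ r₃, y′ ~ p and y ~
    -- y′. Now o, r₁, y, y′, d is a pentagon, so a remote z exists, and p, o, d, y′ with pendants z,
    -- l₁, r₂ form a sunspot.
    no-clone-r₁ : ∀ w → let open Window w in ∀ {p} → Good w p → Witness w p → NoClone o r₁ r₂
    no-clone-r₁ w {p} good wit {d} d~o d~r₂ = decidable-stable (d ≟ r₁) contradict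
      where
      open Window w
      open Good good
      p≁r₃ : ¬ p ~ r₃
      -- The edge closes a pentagon with r₂, r₁ and o, so the cycle has length 5 and r₃ is l₂.
      p≁r₃ p~r₃ = p≁l₂ (subst (p ~_) (wrap-r (pentagon (~-sym o~r₁) (~-sym p~o) p~r₃ (~-sym r₂~r₃) (~-sym r₁~r₂))) p~r₃)
      contradict : ¬ d ≢ r₁
      contradict d≢r₁ with notDominated d≢r₁ | notDominated (d≢r₁ ∘ ≡-sym)
      ... | y′ , y′~d , y′≁r₁ | y , y~r₁ , y≁d = no-witness (wit (pentagon o~r₁ (~-sym y~r₁) y~y′ y′~d d~o))
        where
        y≁p : ¬ y ~ p
        y≁p y~p = ≢-separated (~-sym d~o) y≁d (≡-sym (only-r y~p y~r₁))
        y~r₃ : y ~ r₃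
        y~r₃ = ~-stable λ y≁r₃ → spot o~r₁ r₁~r₂ (~-sym d~r₂) d~o p~o y~r₁ (~-sym r₂~r₃)
          p≁r₂ y≁d (o≁r₃ ∘ ~-sym) (y≁p ∘ ~-sym) y≁r₃ p≁r₃
        y′~p : y′ ~ p
        y′~p = ~-stable λ y′≁p → tri
          (~-stable λ y≁y′ → spot (~-sym o~r₁) (~-sym d~o) d~r₂ (~-sym r₁~r₂) y~r₁ p~o y′~d y≁d p≁r₂ y′≁r₁ y≁p (y′≁p ∘ ~-sym) y≁y′)
          (~-stable λ y′≁r₃ → spot (~-sym d~o) d~r₂ (~-sym r₁~r₂) (~-sym o~r₁) p~o y′~d (~-sym r₂~r₃)
            p≁r₂ y′≁r₁ (o≁r₃ ∘ ~-sym) (y′≁p ∘ ~-sym) y′≁r₃ p≁r₃)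
          y~r₃
        y′≁l₁ : ¬ y′ ~ l₁
        y′≁l₁ y′~l₁ = ≢-separated o~r₁ y′≁r₁ (≡-sym (only-l y′~p y′~l₁))
        y~y′ : y ~ y′
        y~y′ = ~-stable λ y≁y′ → spot (~-sym o~r₁) (~-sym d~o) d~r₂ (~-sym r₁~r₂) y~r₁ l₁~o y′~d
          y≁d l₁≁r₂ y′≁r₁ (λ y~l₁ → apart-l₁r₃ y~l₁ y~r₃) (y′≁l₁ ∘ ~-sym) y≁y′
        no-witness : ¬ (∃ λ z → z ~ p × Remote w z)
        no-witness (z , z~p , rem) = spot p~o (~-sym d~o) (~-sym y′~d) y′~p z~p l₁~o (~-sym d~r₂)
          (off-r₁ d~o d~r₂) (y′≁l₁ ∘ ~-sym) (p≁r₂ ∘ ~-sym) (off-l₁ (~-sym l₂~l₁) l₁~o) l₁≁r₂ (off-r₂ (~-sym r₁~r₂) r₂~r₃)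
          where open Remote rem

    module NoCloneOfCentre (w : Window) {p : V} (good : Good w p)
      (unique-l₁ : NoClone (Window.l₂ w) (Window.l₁ w) (Window.o w))
      (unique-r₁ : NoClone (Window.o w) (Window.r₁ w) (Window.r₂ w)) where
      open Window w
      open Good good

      module _ {d : V} (d~l₁ : d ~ l₁) (d~r₁ : d ~ r₁) (d≢o : d ≢ o) where
        clone≁p : ∀ {e} → e ~ r₁ → e ≢ o → ¬ e ~ p
        clone≁p e~r₁ e≢o e~p = e≢o (only-r e~p e~r₁)

        -- Otherwise r₁, o, l₁, d with pendants a, p, b form a sunspot.
        complete : ∀ {a b} → a ~ r₁ → ¬ a ~ l₁ → b ~ l₁ → ¬ b ~ r₁ → a ~ b
        complete a~r₁ a≁l₁ b~l₁ b≁r₁ = ~-stable λ a≁b → spot (~-sym o~r₁) (~-sym l₁~o) (~-sym d~l₁) d~r₁ a~r₁ p~o b~l₁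
          a≁l₁ (clone≁p d~r₁ d≢o ∘ ~-sym) b≁r₁
          (λ a~p → ≢-separated (~-sym l₁~o) a≁l₁ (≡-sym (only-r a~p a~r₁)))
          (λ p~b → ≢-separated o~r₁ b≁r₁ (≡-sym (only-l (~-sym p~b) b~l₁))) a≁b

        r₂~l₂ : r₂ ~ l₂
        r₂~l₂ = complete (~-sym r₁~r₂) (l₁≁r₂ ∘ ~-sym) l₂~l₁ l₂≁r₁

        -- Otherwise sunspots on e, r₁, o, l₁ make y adjacent to both l₂ and r₂, closing a triangle.
        on-p : ∀ {e y} → e ~ l₁ → e ~ r₁ → y ~ e → ¬ y ~ o → y ~ p
        on-p {e} {y} e~l₁ e~r₁ y~e y≁o = ~-stable λ y≁p → tri
          (~-stable λ y≁r₂ → spot e~r₁ (~-sym o~r₁) (~-sym l₁~o) (~-sym e~l₁) y~e (~-sym r₁~r₂) p~o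
            y≁o (l₁≁r₂ ∘ ~-sym) (e≁p ∘ ~-sym) y≁r₂ (p≁r₂ ∘ ~-sym) y≁p)
          r₂~l₂
          (~-stable λ y≁l₂ → spot e~l₁ l₁~o o~r₁ (~-sym e~r₁) y~e l₂~l₁ p~o
            y≁o l₂≁r₁ (e≁p ∘ ~-sym) y≁l₂ (p≁l₂ ∘ ~-sym) y≁p)
          where
          e≁p : ¬ e ~ p
          e≁p = clone≁p e~r₁ (≢-separated (~-sym y~e) (y≁o ∘ ~-sym))

        Clone : V → Set
        Clone x = x ~ l₁ × x ~ r₁

        -- `unique-r₁` gives y ≁ o, since r₁ is adjacent to v′. So y ~ p by `on-p`, and r₁, r₂, y, v
        -- with pendants v′, l₂, p form a sunspot.
        no-crossing-clones′ : ∀ {v v′ y y′} → Clone v → Clone v′ → Crossing v v′ y y′ → ¬ y ~ y′ → y ~ r₂ → y′ ~ l₂ → ⊥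
        no-crossing-clones′ {v} {v′} {y} {y′} (v~l₁ , v~r₁) (v′~l₁ , v′~r₁) ((y~v , y≁v′) , (y′~v′ , y′≁v)) y≁y′ y~r₂ y′~l₂ =
          spot r₁~r₂ (~-sym y~r₂) y~v v~r₁ v′~r₁ (~-sym r₂~l₂) (~-sym y~p)
            (y≁v′ ∘ ~-sym) (tri′ l₂~l₁ v~l₁) (tri′ p~o (~-sym o~r₁)) (tri′ v′~l₁ l₂~l₁) (p≁l₂ ∘ ~-sym)
            (clone≁p v′~r₁ v′≢o)
          where
          y≁o : ¬ y ~ o
          y≁o y~o = y≁v′ (subst (_~ v′) (≡-sym (unique-r₁ y~o y~r₂)) (~-sym v′~r₁))
          y~p : y ~ p
          y~p = on-p v~l₁ v~r₁ y~v y≁o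
          v′≢o : v′ ≢ o
          v′≢o refl = y′≁v (subst (_~ v) (≡-sym (unique-l₁ y′~l₂ y′~v′)) (~-sym v~l₁))

        -- If y ≁ y′, sunspots on v, l₁, v′, r₁ make one of y, y′ adjacent to r₂ and one adjacent to
        -- l₂. These are different vertices because r₂ ~ l₂.
        no-crossing-clones : ∀ {v v′ y y′} → Clone v → Clone v′ → Crossing v v′ y y′ → y ~ y′
        no-crossing-clones {v} {v′} {y} {y′} cv@(v~l₁ , v~r₁) cv′@(v′~l₁ , v′~r₁) cr@((y~v , y≁v′) , (y′~v′ , y′≁v)) =
          ~-stable contradict
          where
          contradict : ¬ ¬ y ~ y′
          contradict y≁y′ with y ~? r₂
          ... | yes y~r₂ = no-crossing-clones′ cv cv′ cr y≁y′ y~r₂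
            (~-stable λ y′≁l₂ → spot v~l₁ (~-sym v′~l₁) v′~r₁ (~-sym v~r₁) y~v l₂~l₁ y′~v′ y≁v′ l₂≁r₁ y′≁v
              (λ y~l₂ → tri y~r₂ r₂~l₂ y~l₂) (y′≁l₂ ∘ ~-sym) y≁y′)
          ... | no y≁r₂ = no-crossing-clones′ cv′ cv ((y′~v′ , y′≁v) , (y~v , y≁v′)) (y≁y′ ∘ ~-sym) y′~r₂
            (~-stable λ y≁l₂ → spot v~l₁ (~-sym v′~l₁) v′~r₁ (~-sym v~r₁) y~v l₂~l₁ y′~v′ y≁v′ l₂≁r₁ y′≁v
              y≁l₂ (λ l₂~y′ → tri y′~r₂ r₂~l₂ (~-sym l₂~y′)) y≁y′)
            where
            y′~r₂ : y′ ~ r₂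
            y′~r₂ = ~-stable λ y′≁r₂ → spot v~r₁ (~-sym v′~r₁) v′~l₁ (~-sym v~l₁) y~v (~-sym r₁~r₂) y′~v′
              y≁v′ (l₁≁r₂ ∘ ~-sym) y′≁v y≁r₂ (y′≁r₂ ∘ ~-sym) y≁y′

        Side : V → Set
        Side x = x ~ r₁ × ¬ x ~ l₁

        no-crossing-sides : ∀ {a a′ y y′} → Side a → Side a′ → Crossing a a′ y y′ → y ~ y′
        no-crossing-sides {a} {a′} {y} {y′} (a~r₁ , a≁l₁) (a′~r₁ , a′≁l₁) ((y~a , y≁a′) , (y′~a′ , y′≁a)) =
          ~-stable λ y≁y′ → spot a~l₂ (~-sym a′~l₂) a′~r₁ (~-sym a~r₁) y~a (~-sym l₂~l₁) y′~a′
            y≁a′ (tri′ l₁~o (~-sym o~r₁)) y′≁a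
            (λ y~l₁ → y≁a′ (~-sym (complete a′~r₁ a′≁l₁ y~l₁ (tri′ y~a (~-sym a~r₁)))))
            (λ l₁~y′ → y′≁a (~-sym (complete a~r₁ a≁l₁ (~-sym l₁~y′) (tri′ y′~a′ (~-sym a′~r₁))))) y≁y′
          where
          a~l₂ : a ~ l₂
          a~l₂ = complete a~r₁ a≁l₁ l₂~l₁ l₂≁r₁
          a′~l₂ : a′ ~ l₂
          a′~l₂ = complete a′~r₁ a′≁l₁ l₂~l₁ l₂≁r₁

        -- The neighbours of r₁ split into those adjacent to l₁ and the others, at most two of each.
        -- The vertices passed to `avoid` for exclusion are fillers.
        contradiction-from-clone : ⊥
        contradiction-from-clone =
          let u , u~r₁ , not-clone , not-side , _ =
                avoid (λ x → (x ~? l₁) ×-dec (x ~? r₁)) (λ x → (x ~? r₁) ×-dec ¬? (x ~? l₁))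
                  (complete-crossings⇒AtMostTwo no-crossing-clones) (complete-crossings⇒AtMostTwo no-crossing-sides) r₁ r₁ r₁
          in not-side (u~r₁ , λ u~l₁ → not-clone (u~l₁ , u~r₁))

      unique-o : NoClone l₁ o r₁
      unique-o {d} d~l₁ d~r₁ = decidable-stable (d ≟ o) (contradiction-from-clone d~l₁ d~r₁)

    module NoCloneOfSecond (w : Window) {p : V} (good : Good w p) (wit : Witness w p)
      (unique-l₁ : NoClone (Window.l₂ w) (Window.l₁ w) (Window.o w))
      (unique-o : NoClone (Window.l₁ w) (Window.o w) (Window.r₁ w))
      (unique-r₁ : NoClone (Window.o w) (Window.r₁ w) (Window.r₂ w)) where
      open Window w
      open Good good

      p≁r₃ : ¬ p ~ r₃
      p≁r₃ p~r₃ = p≁l₂ (subst (p ~_) (wrap-r (pentagon (~-sym o~r₁) (~-sym p~o) p~r₃ (~-sym r₂~r₃) (~-sym r₁~r₂))) p~r₃)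

      -- If u ≢ r₁, a neighbour g of u missing r₁ is adjacent to p and r₂, by sunspots on u, o, r₁,
      -- a. Then p, g, r₂, r₁, o is a pentagon, so a remote z exists, and p, o, u, g with pendants
      -- z, l₁, a form a sunspot.
      clone≁o-nbr : ∀ {a u} → a ~ r₁ → a ~ r₃ → a ≢ r₂ → u ~ o → u ~ a → u ≡ r₁
      clone≁o-nbr {a} {u} a~r₁ a~r₃ a≢r₂ u~o u~a = decidable-stable (u ≟ r₁) contradict
        where
        a≢o : a ≢ o
        a≢o refl = o≁r₃ a~r₃
        p≁a : ¬ p ~ a
        p≁a p~a = a≢o (only-r (~-sym p~a) a~r₁)
        a≁l₁ : ¬ a ~ l₁
        a≁l₁ a~l₁ = a≢o (unique-o a~l₁ a~r₁)
        contradict : ¬ u ≢ r₁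
        contradict u≢r₁ with notDominated u≢r₁
        ... | g , g~u , g≁r₁ = no-witness (wit (pentagon (~-sym g~p) (proj₂ (on-p-r₂ g~u g≁r₁)) (~-sym r₁~r₂) (~-sym o~r₁) (~-sym p~o)))
          where
          u≁r₂ : ¬ u ~ r₂
          u≁r₂ u~r₂ = u≢r₁ (unique-r₁ u~o u~r₂)
          on-p-r₂ : ∀ {h} → h ~ u → ¬ h ~ r₁ → h ~ p × h ~ r₂
          on-p-r₂ {h} h~u h≁r₁ = h~p , ~-stable λ h≁r₂ →
            spot u~o o~r₁ (~-sym a~r₁) (~-sym u~a) h~u l₁~o (~-sym r₁~r₂) h≁r₁ (a≁l₁ ∘ ~-sym) (u≁r₂ ∘ ~-sym)
              (λ h~l₁ → ≢-separated o~r₁ h≁r₁ (≡-sym (only-l h~p h~l₁))) l₁≁r₂ h≁r₂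
            where
            h~p : h ~ p
            h~p = ~-stable λ h≁p → tri
              (~-stable λ h≁r₂ → spot u~o o~r₁ (~-sym a~r₁) (~-sym u~a) h~u p~o (~-sym r₁~r₂) h≁r₁ p≁a (u≁r₂ ∘ ~-sym) h≁p p≁r₂ h≁r₂)
              r₂~r₃
              (~-stable λ h≁r₃ → spot (~-sym u~a) u~o o~r₁ (~-sym a~r₁) (~-sym a~r₃) h~u p~o (o≁r₃ ∘ ~-sym) h≁r₁ p≁a
                (h≁r₃ ∘ ~-sym) h≁p (p≁r₃ ∘ ~-sym))
          g~p : g ~ p
          g~p = proj₁ (on-p-r₂ g~u g≁r₁)
          no-witness : ¬ (∃ λ z → z ~ p × Remote w z)
          no-witness (z , z~p , rem) = spot p~o (~-sym u~o) (~-sym g~u) g~p z~p l₁~o (~-sym u~a)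
            (λ z~u → off-r₂ (~-sym r₁~r₂) r₂~r₃ (proj₂ (on-p-r₂ z~u (off-r₁ (~-sym o~r₁) r₁~r₂))))
            (λ l₁~g → ≢-separated o~r₁ g≁r₁ (≡-sym (only-l g~p (~-sym l₁~g)))) (p≁a ∘ ~-sym)
            (off-l₁ (~-sym l₂~l₁) l₁~o) (a≁l₁ ∘ ~-sym) (off-r₂ a~r₁ a~r₃)
            where open Remote rem

      Clone : V → Set
      Clone x = x ~ r₁ × x ~ r₃

      clone-nbr≁o : ∀ {a u} → Clone a → u ~ a → u ≢ r₁ → ¬ u ~ o
      clone-nbr≁o {a} (a~r₁ , a~r₃) u~a u≢r₁ u~o with a ≟ r₂
      ... | yes refl = u≢r₁ (unique-r₁ u~o u~a)
      ... | no a≢r₂ = u≢r₁ (clone≁o-nbr a~r₁ a~r₃ a≢r₂ u~o u~a)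

      no-crossing-clones : ∀ {a a′ u u′} → Clone a → Clone a′ → Crossing a a′ u u′ → u ~ u′
      no-crossing-clones {a} {a′} {u} {u′} ca@(a~r₁ , a~r₃) ca′@(a′~r₁ , a′~r₃) ((u~a , u≁a′) , (u′~a′ , u′≁a)) =
        ~-stable λ u≁u′ → spot a~r₁ (~-sym a′~r₁) a′~r₃ (~-sym a~r₃) u~a o~r₁ u′~a′ u≁a′ o≁r₃ u′≁a
          (clone-nbr≁o ca u~a (λ { refl → u≁a′ (~-sym a′~r₁) }))
          (clone-nbr≁o ca′ u′~a′ (λ { refl → u′≁a (~-sym a~r₁) }) ∘ ~-sym) u≁u′

      -- Vertices u and u′ separating r₂ from a clone a are adjacent. For a neighbour q of r₃
      -- missing r₁ and o, sunspots on r₁, r₂, r₃, a make both adjacent to q, a triangle.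
      unique-r₂ : NoClone r₁ r₂ r₃
      unique-r₂ {a} a~r₁ a~r₃ = decidable-stable (a ≟ r₂) contradict
        where
        contradict : ¬ a ≢ r₂
        -- Excluding l₁ matters in length 5: there r₃ is l₂, and l₁ is its only common neighbour
        -- with o.
        contradict a≢r₂ = refute (avoid₁ (λ x → (x ~? r₁) ×-dec (x ~? r₃)) (complete-crossings⇒AtMostTwo no-crossing-clones) r₃ l₁ l₁)
          (notDominated a≢r₂) (notDominated (a≢r₂ ∘ ≡-sym))
          where
          refute : (∃ λ q → q ~ r₃ × ¬ Clone q × q ≢ l₁ × q ≢ l₁) → (∃ λ u → u ~ a × ¬ u ~ r₂) → (∃ λ u → u ~ r₂ × ¬ u ~ a) → ⊥
          refute (q , q~r₃ , not-clone , q≢l₁ , _) (u′ , u′~a , u′≁r₂) (u , u~r₂ , u≁a) =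
            tri u~q (~-sym u′~q) (no-crossing-clones cr₂ ca ((u~r₂ , u≁a) , (u′~a , u′≁r₂)))
            where
            ca : Clone a
            ca = a~r₁ , a~r₃
            cr₂ : Clone r₂
            cr₂ = ~-sym r₁~r₂ , r₂~r₃
            q≁r₁ : ¬ q ~ r₁
            q≁r₁ q~r₁ = not-clone (q~r₁ , q~r₃)
            q≁o : ¬ q ~ o
            q≁o q~o = q≢l₁ (unique-l₁ (subst (q ~_) (wrap-r (pentagon (~-sym o~r₁) (~-sym q~o) q~r₃ (~-sym r₂~r₃) (~-sym r₁~r₂))) q~r₃) q~o)
            u~q : u ~ q
            u~q = ~-stable λ u≁q → spot r₁~r₂ r₂~r₃ (~-sym a~r₃) a~r₁ o~r₁ u~r₂ q~r₃ o≁r₃ u≁a q≁r₁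
              (clone-nbr≁o cr₂ u~r₂ (λ { refl → u≁a (~-sym a~r₁) }) ∘ ~-sym) u≁q (q≁o ∘ ~-sym)
            u′~q : u′ ~ q
            u′~q = ~-stable λ u′≁q → spot (~-sym a~r₁) a~r₃ (~-sym r₂~r₃) (~-sym r₁~r₂) o~r₁ u′~a q~r₃ o≁r₃ u′≁r₂ q≁r₁
              (clone-nbr≁o ca u′~a (λ { refl → u′≁r₂ r₁~r₂ }) ∘ ~-sym) u′≁q (q≁o ∘ ~-sym)

    record NoClones (w : Window) : Set where
      open Window w
      field
        unique-l₂ : NoClone l₃ l₂ l₁
        unique-l₁ : NoClone l₂ l₁ o
        unique-o : NoClone l₁ o r₁
        unique-r₁ : NoClone o r₁ r₂
        unique-r₂ : NoClone r₁ r₂ r₃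

    good⇒noClones : ∀ w {p} → Good w p → Witness w p → NoClones w
    good⇒noClones w good wit = record
      { unique-l₂ = λ a b → NoCloneOfSecond.unique-r₂ (mirror w) (mirror-good good) (mirror-witness wit)
          (swap r₁!) (swap o!) (swap l₁!) b a
      ; unique-l₁ = l₁! ; unique-o = o! ; unique-r₁ = r₁!
      ; unique-r₂ = NoCloneOfSecond.unique-r₂ w good wit l₁! o! r₁! }
      where
      open Window w
      swap : ∀ {x m y} → NoClone x m y → NoClone y m x
      swap unique a b = unique b a
      r₁! : NoClone o r₁ r₂
      r₁! = no-clone-r₁ w good wit
      l₁! : NoClone l₂ l₁ o
      l₁! = swap (no-clone-r₁ (mirror w) (mirror-good good) (mirror-witness wit))
      o! : NoClone l₁ o r₁
      o! = NoCloneOfCentre.unique-o w good l₁! r₁!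

    module Propagate (w : Window) {p : V} (good : Good w p) (noClones : NoClones w) where
      open Window w
      open Good good
      open NoClones noClones

      -- With r₁ and r₂ these vertices form a pentagon, so the window wraps around.
      common-o-r₃ : ∀ {v} → v ~ o → v ~ r₃ → v ≡ l₁ × r₃ ≡ l₂
      common-o-r₃ {v} v~o v~r₃ = unique-l₁ (subst (v ~_) r₃≡l₂ v~r₃) v~o , r₃≡l₂
        where
        r₃≡l₂ : r₃ ≡ l₂
        r₃≡l₂ = wrap-r (pentagon (~-sym o~r₁) (~-sym v~o) v~r₃ (~-sym r₂~r₃) (~-sym r₁~r₂))

      common-l₁-r₂ : ∀ {v} → v ~ l₁ → v ~ r₂ → v ≡ r₃
      common-l₁-r₂ {v} v~l₁ v~r₂ = trans (unique-l₂ (subst (v ~_) (≡-sym (wrap-l five)) v~r₂) v~l₁) (≡-sym (wrap-r five))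
        where
        five : Five
        five = pentagon (~-sym l₁~o) (~-sym v~l₁) v~r₂ (~-sym r₁~r₂) (~-sym o~r₁)

      module _ {v : V} (v~r₁ : v ~ r₁) (v≢o : v ≢ o) (v≢r₂ : v ≢ r₂) where
        v≁l₁ : ¬ v ~ l₁
        v≁l₁ v~l₁ = v≢o (unique-o v~l₁ v~r₁)

        v≁r₃ : ¬ v ~ r₃
        v≁r₃ v~r₃ = v≢r₂ (unique-r₂ v~r₁ v~r₃)

        p≁v : ¬ p ~ v
        p≁v p~v = v≢o (only-r (~-sym p~v) v~r₁)

        -- Suppose y ≢ r₁; take h in N(v) minus N(o) and g in N(y) minus N(r₁). If one of them
        -- misses r₂, sunspots on o, y, v, r₁ make it adjacent to p and l₁, hence equal to o by
        -- `only-l`. So both are adjacent to r₂, and o, y, v, r₁ with pendants l₁, g, h form a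
        -- sunspot.
        pendant-only-l : ∀ {y} → y ~ v → y ~ o → y ≡ r₁
        pendant-only-l {y} y~v y~o = decidable-stable (y ≟ r₁) contradict
          where
          contradict : ¬ y ≢ r₁
          contradict y≢r₁ with notDominated v≢o | notDominated y≢r₁
          ... | h , h~v , h≁o | g , g~y , g≁r₁ =
            spot (~-sym y~o) y~v v~r₁ (~-sym o~r₁) l₁~o g~y h~v (v≁l₁ ∘ ~-sym) g≁r₁ h≁o
              (λ l₁~g → g-contradiction (common-l₁-r₂ (~-sym l₁~g) g~r₂)) (tri′ g~r₂ h~r₂)
              (λ l₁~h → v≁r₃ (subst (v ~_) (common-l₁-r₂ (~-sym l₁~h) h~r₂) (~-sym h~v)))
            where
            y≁r₂ : ¬ y ~ r₂
            y≁r₂ y~r₂ = y≢r₁ (unique-r₁ y~o y~r₂)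
            h~r₂ : h ~ r₂
            h~r₂ = ~-stable λ h≁r₂ → h≁o-refuted
              (only-l (~-stable λ h≁p → spot v~r₁ (~-sym o~r₁) (~-sym y~o) y~v h~v (~-sym r₁~r₂) p~o
                         h≁o (y≁r₂ ∘ ~-sym) p≁v h≁r₂ (p≁r₂ ∘ ~-sym) h≁p)
                      (~-stable λ h≁l₁ → spot v~r₁ (~-sym o~r₁) (~-sym y~o) y~v h~v (~-sym r₁~r₂) l₁~o
                         h≁o (y≁r₂ ∘ ~-sym) (v≁l₁ ∘ ~-sym) h≁r₂ (l₁≁r₂ ∘ ~-sym) h≁l₁))
              where
              h≁o-refuted : h ≢ o
              h≁o-refuted refl = tri h~v v~r₁ o~r₁
            g~r₂ : g ~ r₂
            g~r₂ = ~-stable λ g≁r₂ → ≢-separated o~r₁ g≁r₁ (≡-sym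
              (only-l (~-stable λ g≁p → spot y~o o~r₁ (~-sym v~r₁) (~-sym y~v) g~y p~o (~-sym r₁~r₂)
                         g≁r₁ p≁v (y≁r₂ ∘ ~-sym) g≁p p≁r₂ g≁r₂)
                      (~-stable λ g≁l₁ → spot y~o o~r₁ (~-sym v~r₁) (~-sym y~v) g~y l₁~o (~-sym r₁~r₂)
                         g≁r₁ (v≁l₁ ∘ ~-sym) (y≁r₂ ∘ ~-sym) g≁l₁ l₁≁r₂ g≁r₂)))
            g-contradiction : g ≢ r₃
            g-contradiction refl = v≁l₁ (subst (v ~_) (proj₁ (common-o-r₃ y~o (~-sym g~y))) (~-sym y~v))

      module _ {g : V} (g≁o : ¬ g ~ o) where
        -- For common neighbours x, x′ of r₁ and g, the vertex o is a pendant of r₁ in a sunspot on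
        -- x, r₁, x′, g; the pendants f, f′ miss it by `pendant-only-l`.
        r₁-codegree : AtMostTwo (λ x → x ~ r₁ × x ~ g)
        r₁-codegree = complete-crossings⇒AtMostTwo crossing
          where
          o-free : ∀ {x f} → x ~ r₁ → x ~ g → f ~ x → f ≢ r₁ → ¬ f ~ o
          o-free {x} x~r₁ x~g f~x f≢r₁ f~o with x ≟ r₂
          ... | yes refl = f≢r₁ (unique-r₁ f~o f~x)
          ... | no x≢r₂ = f≢r₁ (pendant-only-l x~r₁ (λ { refl → g≁o (~-sym x~g) }) x≢r₂ f~x f~o)
          crossing : ∀ {x x′ f f′} → x ~ r₁ × x ~ g → x′ ~ r₁ × x′ ~ g → Crossing x x′ f f′ → f ~ f′
          crossing (x~r₁ , x~g) (x′~r₁ , x′~g) ((f~x , f≁x′) , (f′~x′ , f′≁x)) =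
            ~-stable λ f≁f′ → spot x~r₁ (~-sym x′~r₁) x′~g (~-sym x~g) f~x o~r₁ f′~x′ f≁x′ (g≁o ∘ ~-sym) f′≁x
              (o-free x~r₁ x~g f~x λ { refl → f≁x′ (~-sym x′~r₁) })
              (o-free x′~r₁ x′~g f′~x′ (λ { refl → f′≁x (~-sym x~r₁) }) ∘ ~-sym) f≁f′

      module _ {v : V} (v~r₁ : v ~ r₁) (v≢o : v ≢ o) (v≢r₂ : v ≢ r₂) where
        -- If g ≢ r₁, then g ≁ o, and the codegree bound yields a neighbour x ≢ o of r₁ missing g.
        -- Take q in N(v) minus N(r₂) and q′ in N(g) minus N(r₁): sunspots on r₁, r₂, g, v give q ~
        -- r₃ and then q′ ~ o. Finally r₁, r₂, g, v with pendants x, r₃, q′ form a sunspot.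
        pendant-only-r : ∀ {g} → g ~ v → g ~ r₂ → g ≡ r₁
        pendant-only-r {g} g~v g~r₂ = decidable-stable (g ≟ r₁) contradict
          where
          contradict : ¬ g ≢ r₁
          contradict g≢r₁ = refute (avoid₁ (λ x → (x ~? r₁) ×-dec (x ~? g)) (r₁-codegree g≁o) r₁ o o) (notDominated v≢r₂) (notDominated g≢r₁)
            where
            g≁o : ¬ g ~ o
            g≁o g~o = g≢r₁ (unique-r₁ g~o g~r₂)
            refute : (∃ λ x → x ~ r₁ × ¬ (x ~ r₁ × x ~ g) × x ≢ o × x ≢ o) → (∃ λ q → q ~ v × ¬ q ~ r₂) → (∃ λ q → q ~ g × ¬ q ~ r₁) → ⊥
            refute (x , x~r₁ , not-common , x≢o , _) (q , q~v , q≁r₂) (q′ , q′~g , q′≁r₁) =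
              spot r₁~r₂ (~-sym g~r₂) g~v v~r₁ x~r₁ (~-sym r₂~r₃) q′~g x≁g (v≁r₃′ ∘ ~-sym) q′≁r₁
                (λ x~r₃ → x≢r₂ (unique-r₂ x~r₁ x~r₃)) r₃≁q′
                (λ x~q′ → tri′ g~r₂ r₁~r₂ (subst (g ~_) (pendant-only-l x~r₁ x≢o x≢r₂ (~-sym x~q′) q′~o) (~-sym q′~g)))
              where
              v≁r₃′ : ¬ v ~ r₃
              v≁r₃′ = v≁r₃ v~r₁ v≢o v≢r₂
              x≁g : ¬ x ~ g
              x≁g x~g = not-common (x~r₁ , x~g)
              x≢r₂ : x ≢ r₂
              x≢r₂ refl = x≁g (~-sym g~r₂)
              q≁o : ¬ q ~ o
              q≁o q~o = ≢-separated r₁~r₂ q≁r₂ (≡-sym (pendant-only-l v~r₁ v≢o v≢r₂ q~v q~o))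
              q~r₃ : q ~ r₃
              q~r₃ = ~-stable λ q≁r₃ → spot v~r₁ r₁~r₂ (~-sym g~r₂) g~v q~v o~r₁ (~-sym r₂~r₃)
                q≁r₂ (g≁o ∘ ~-sym) (v≁r₃′ ∘ ~-sym) q≁o o≁r₃ q≁r₃
              q′~o : q′ ~ o
              q′~o = ~-stable λ q′≁o → tri
                (~-stable λ q≁q′ → spot (~-sym v~r₁) (~-sym g~v) g~r₂ (~-sym r₁~r₂) o~r₁ q~v q′~g
                  (g≁o ∘ ~-sym) q≁r₂ q′≁r₁ (q≁o ∘ ~-sym) q≁q′ (q′≁o ∘ ~-sym))
                (~-stable λ q′≁r₃ → spot g~r₂ (~-sym r₁~r₂) (~-sym v~r₁) (~-sym g~v) q′~g (~-sym r₂~r₃) o~r₁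
                  q′≁r₁ (v≁r₃′ ∘ ~-sym) (g≁o ∘ ~-sym) q′≁r₃ (o≁r₃ ∘ ~-sym) q′≁o)
                q~r₃
              r₃≁q′ : ¬ r₃ ~ q′
              r₃≁q′ r₃~q′ = v≁r₃′ (subst (v ~_) (common-l₁-r₂ g~l₁ g~r₂) (~-sym g~v))
                where
                g~l₁ : g ~ l₁
                g~l₁ = subst (g ~_) (proj₁ (common-o-r₃ q′~o (~-sym r₃~q′))) (~-sym q′~g)

-- Parity, walks, and arcs of a shortest odd closed walk.

odd : ℕ → Bool
odd zero = false
odd (suc k) = not (odd k)

odd-+ : ∀ i j → odd (i + j) ≡ odd i xor odd j
odd-+ zero j = refl
odd-+ (suc i) j rewrite odd-+ i j = not-xor (odd i)
  where
  not-xor : ∀ x {y} → not (x xor y) ≡ not x xor y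
  not-xor true {y} = Bool.not-involutive y
  not-xor false = refl

module Walks {n : ℕ} (G : Graph n) where

  open Adjacency G

  infixr 5 _∷_ _++ʷ_

  data Walk : ℕ → V → V → Set where
    [] : ∀ {u} → Walk 0 u u
    _∷_ : ∀ {k u v w} → u ~ v → Walk k v w → Walk (suc k) u w

  _++ʷ_ : ∀ {j k u v w} → Walk j u v → Walk k v w → Walk (j + k) u w
  [] ++ʷ q = q
  (e ∷ p) ++ʷ q = e ∷ (p ++ʷ q)

  reverse : ∀ {k u v} → Walk k u v → Walk k v u
  reverse [] = []
  reverse {suc k} {u} {w} (e ∷ p) = subst (λ j → Walk j w u) (+-comm k 1) (reverse p ++ʷ (~-sym e ∷ []))

  -- The walk is unrolled to a periodic sequence, so that indices need no modular arithmetic.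
  record ShortestOddCycle (ℓ : ℕ) : Set where
    field
      at : ℕ → V
      step : ∀ i → at i ~ at (suc i)
      periodic : ∀ i → at (ℓ + i) ≡ at i
      odd-length : odd ℓ ≡ true
      shortest : ∀ {k v} → odd k ≡ true → Walk k v v → ℓ ≤ k
      5≤ℓ : 5 ≤ ℓ

  shift : ∀ {ℓ} → ℕ → ShortestOddCycle ℓ → ShortestOddCycle ℓ
  shift {ℓ} s C = record
    { at = λ i → at (i + s) ; step = λ i → step (i + s)
    ; periodic = λ i → trans (cong at (+-assoc ℓ i s)) (periodic (i + s))
    ; odd-length = odd-length ; shortest = shortest ; 5≤ℓ = 5≤ℓ }
    where open ShortestOddCycle C

  -- Unlike in `shift 1 C`, the new `at i` is `at (suc i)` by computation.
  shift₁ : ∀ {ℓ} → ShortestOddCycle ℓ → ShortestOddCycle ℓ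
  shift₁ {ℓ} C = record
    { at = at ∘ suc ; step = step ∘ suc
    ; periodic = λ i → trans (cong at (≡-sym (+-suc ℓ i))) (periodic (suc i))
    ; odd-length = odd-length ; shortest = shortest ; 5≤ℓ = 5≤ℓ }
    where open ShortestOddCycle C

  module Arcs {ℓ : ℕ} (C : ShortestOddCycle ℓ) where
    open ShortestOddCycle C

    segment : ∀ d i → Walk d (at i) (at (d + i))
    segment zero i = []
    segment (suc d) i = step i ∷ subst (Walk d (at (suc i))) (cong at (+-suc d i)) (segment d (suc i))

    around : ∀ d e i → d + e ≡ ℓ → at (e + (d + i)) ≡ at i
    around d e i refl = trans (cong at (trans (≡-sym (+-assoc e d i)) (cong (_+ i) (+-comm e d)))) (periodic i)

    -- One of the two arcs between the ends closes the walk to an odd closed walk.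
    arcs : ∀ {k} d e i → d + e ≡ ℓ → Walk k (at i) (at (d + i)) → (odd (d + k) ≡ true × e ≤ k) ⊎ (odd (e + k) ≡ true × d ≤ k)
    arcs {k} d e i d+e≡ℓ p with odd (d + k) in eq
    ... | true = inj₁ (refl , +-cancelˡ-≤ d e k (subst (_≤ d + k) (≡-sym d+e≡ℓ) (shortest eq (segment d i ++ʷ reverse p))))
    ... | false = inj₂ (odd-e+k , +-cancelʳ-≤ e d k (subst (_≤ k + e) (≡-sym d+e≡ℓ) (shortest (trans (cong odd (+-comm k e)) odd-e+k) closed)))
      where
      closed : Walk (k + e) (at i) (at i)
      closed = subst (Walk (k + e) (at i)) (around d e i d+e≡ℓ) (p ++ʷ segment e (d + i))
      parity : ∀ x y z → x xor y ≡ true → x xor z ≡ false → y xor z ≡ true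
      parity true false true _ _ = refl
      parity true true _ () _
      parity true false false _ ()
      parity false true false _ _ = refl
      parity false false _ () _
      parity false true true _ ()
      odd-e+k : odd (e + k) ≡ true
      odd-e+k = trans (odd-+ e k) (parity (odd d) (odd e) (odd k)
        (trans (≡-sym (odd-+ d e)) (trans (cong odd d+e≡ℓ) odd-length)) (trans (≡-sym (odd-+ d k)) eq))

    rest : ∀ d → d ≤ 5 → ∃ λ e → d + e ≡ ℓ
    rest d d≤5 = ℓ ∸ d , m+[n∸m]≡n (≤-trans d≤5 5≤ℓ)

    pentagon : ∀ {a b c d e} → a ~ b → b ~ c → c ~ d → d ~ e → e ~ a → ℓ ≡ 5
    pentagon ab bc cd de ea = ≤-antisym (shortest refl (ab ∷ bc ∷ cd ∷ de ∷ ea ∷ [])) 5≤ℓ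

    no-chord₃ : ∀ i → ¬ at i ~ at (3 + i)
    no-chord₃ i chord with rest 3 (≤ᵇ⇒≤ 3 5 tt)
    ... | e , eq with arcs 3 e i eq (chord ∷ [])
    ... | inj₁ (() , _)
    ... | inj₂ (_ , s≤s ())

    apart₄ : ∀ i {v} → v ~ at i → ¬ v ~ at (4 + i)
    apart₄ i a b with rest 4 (≤ᵇ⇒≤ 4 5 tt)
    ... | e , eq with arcs 4 e i eq (~-sym a ∷ b ∷ [])
    ... | inj₁ (() , _)
    ... | inj₂ (_ , s≤s (s≤s ()))

    -- As d + e is odd, d + k is odd only if e and k have the same parity.
    parity-clash : ∀ {e k} d → d + e ≡ ℓ → odd (d + k) ≡ true → odd e ≡ not (odd k) → ⊥
    parity-clash {e} {k} d d+e≡ℓ odd-d+k e≢k = clash (odd d) (odd k)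
      (trans (≡-sym (odd-+ d k)) odd-d+k)
      (trans (cong (odd d xor_) (≡-sym e≢k)) (trans (≡-sym (odd-+ d e)) (trans (cong odd d+e≡ℓ) odd-length)))
      where
      clash : ∀ x y → x xor y ≡ true → x xor not y ≡ true → ⊥
      clash true true () _
      clash true false _ ()
      clash false true _ ()
      clash false false () _

    -- Translates a pair of indices into the lengths `suc d` and `suc e` of the two arcs between
    -- them.
    gap : ∀ {j k} → j < k → k < ℓ → ∃₂ λ d e → k ≡ suc d + j × suc d + suc e ≡ ℓ
    gap {j} {k} j<k k<ℓ with ℕₚ.m≤n⇒∃[o]m+o≡n j<k | ℕₚ.m≤n⇒∃[o]m+o≡n k<ℓ
    ... | d , refl | e , refl = d , e + j , cong suc (+-comm j d) , trans (cong suc (+-suc d (e + j))) (cong (2 +_) lemma)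
      where
      lemma : d + (e + j) ≡ j + d + e
      lemma = trans (cong (d +_) (+-comm e j)) (trans (≡-sym (+-assoc d j e)) (cong (_+ e) (+-comm d j)))

    not-joined₀ : ∀ d e i → suc d + suc e ≡ ℓ → at i ≢ at (suc d + i)
    not-joined₀ d e i eq same with arcs (suc d) (suc e) i eq (subst (Walk 0 (at i)) same [])
    ... | inj₁ (_ , ())
    ... | inj₂ (_ , ())

    joined₁ : ∀ d e i → suc d + suc e ≡ ℓ → at i ~ at (suc d + i) → d ≡ 0 ⊎ e ≡ 0
    joined₁ d e i eq a with arcs (suc d) (suc e) i eq (a ∷ [])
    ... | inj₁ (_ , s≤s z≤n) = inj₂ refl
    ... | inj₂ (_ , s≤s z≤n) = inj₁ refl

    -- By `arcs` some arc is no longer than the walk of length 2, and parity rules out length 1. The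
    -- argument for `joined₃` is analogous.
    joined₂ : ∀ d e i {v} → suc d + suc e ≡ ℓ → v ~ at i → v ~ at (suc d + i) → d ≡ 1 ⊎ e ≡ 1
    joined₂ d e i eq a b with arcs (suc d) (suc e) i eq (~-sym a ∷ b ∷ [])
    ... | inj₁ (o , s≤s z≤n) = ⊥-elim (parity-clash (suc d) eq o refl)
    ... | inj₁ (_ , s≤s (s≤s z≤n)) = inj₂ refl
    ... | inj₂ (o , s≤s z≤n) = ⊥-elim (parity-clash (suc e) (trans (+-comm (suc e) (suc d)) eq) o refl)
    ... | inj₂ (_ , s≤s (s≤s z≤n)) = inj₁ refl

    joined₃ : ∀ d e i {u v} → suc d + suc e ≡ ℓ → u ~ at i → u ~ v → v ~ at (suc d + i) →
      (d ≡ 0 ⊎ d ≡ 2) ⊎ (e ≡ 0 ⊎ e ≡ 2)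
    joined₃ d e i eq a b c with arcs (suc d) (suc e) i eq (~-sym a ∷ b ∷ c ∷ [])
    ... | inj₁ (_ , s≤s z≤n) = inj₂ (inj₁ refl)
    ... | inj₁ (o , s≤s (s≤s z≤n)) = ⊥-elim (parity-clash (suc d) eq o refl)
    ... | inj₁ (_ , s≤s (s≤s (s≤s z≤n))) = inj₂ (inj₂ refl)
    ... | inj₂ (_ , s≤s z≤n) = inj₁ (inj₁ refl)
    ... | inj₂ (o , s≤s (s≤s z≤n)) = ⊥-elim (parity-clash (suc e) (trans (+-comm (suc e) (suc d)) eq) o refl)
    ... | inj₂ (_ , s≤s (s≤s (s≤s z≤n))) = inj₁ (inj₂ refl)

-- Propagation around the cycle.

module OddCycles {n : ℕ} (G : Graph n) (critical : Adjacency.Critical G) where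

  open CriticalGraph G critical public
  open Walks G public

  -- Every neighbour v of at (1 + i) off the cycle can serve as its pendant.
  record CloneFree {ℓ : ℕ} (C : ShortestOddCycle ℓ) : Set where
    open ShortestOddCycle C
    field
      unique : ∀ i → NoClone (at i) (at (1 + i)) (at (2 + i))
      only-l : ∀ i {v g} → v ~ at (1 + i) → v ≢ at i → v ≢ at (2 + i) → g ~ v → g ~ at i → g ≡ at (1 + i)
      only-r : ∀ i {v g} → v ~ at (1 + i) → v ≢ at i → v ≢ at (2 + i) → g ~ v → g ~ at (2 + i) → g ≡ at (1 + i)
      codegree : ∀ i {g} → ¬ g ~ at i → AtMostTwo (λ x → x ~ at (1 + i) × x ~ g)

  FarFrom : ∀ {ℓ} → ShortestOddCycle ℓ → V → Set
  FarFrom C z = ∀ i {d} → d ~ at i → d ~ at (2 + i) → ¬ z ~ d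
    where open ShortestOddCycle C

  module _ {ℓ : ℕ} (C : ShortestOddCycle ℓ) where
    open ShortestOddCycle C
    open Arcs C
    open Windows (ℓ ≡ 5) pentagon

    window : ℕ → Window
    window k = record
      { l₃ = at k ; l₂ = at (1 + k) ; l₁ = at (2 + k) ; o = at (3 + k)
      ; r₁ = at (4 + k) ; r₂ = at (5 + k) ; r₃ = at (6 + k)
      ; l₃~l₂ = step k ; l₂~l₁ = step (1 + k) ; l₁~o = step (2 + k)
      ; o~r₁ = step (3 + k) ; r₁~r₂ = step (4 + k) ; r₂~r₃ = step (5 + k)
      ; l₃≁o = no-chord₃ k ; l₂≁r₁ = no-chord₃ (1 + k) ; l₁≁r₂ = no-chord₃ (2 + k) ; o≁r₃ = no-chord₃ (3 + k)
      ; apart-l₃r₁ = apart₄ k ; apart-l₂r₂ = apart₄ (1 + k) ; apart-l₁r₃ = apart₄ (2 + k)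
      ; wrap-l = λ { refl → ≡-sym (periodic k) } ; wrap-r = λ { refl → periodic (1 + k) } }

    module _ {z p : V} (far : FarFrom C z) (z~p : z ~ p) (p~3 : p ~ at 3) where
      remote : Remote (window 0) z
      remote = record { off-l₂ = far 0 ; off-l₁ = far 1 ; off-o = far 2 ; off-r₁ = far 3 ; off-r₂ = far 4 }

      initial : Good (window 0) p
      initial = remote⇒good (window 0) remote z~p p~3

      noClones₀ : NoClones (window 0)
      noClones₀ = good⇒noClones (window 0) initial λ _ → z , z~p , remote

      Unique : ℕ → Set
      Unique i = NoClone (at i) (at (1 + i)) (at (2 + i))

      -- The five inner vertices of the initial window are the whole pentagon.
      all-unique : ℓ ≡ 5 → ∀ i → Unique i
      all-unique _ 0 = NoClones.unique-l₂ noClones₀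
      all-unique _ 1 = NoClones.unique-l₁ noClones₀
      all-unique _ 2 = NoClones.unique-o noClones₀
      all-unique _ 3 = NoClones.unique-r₁ noClones₀
      all-unique _ 4 = NoClones.unique-r₂ noClones₀
      all-unique refl (suc (suc (suc (suc (suc i))))) {d} a b =
        trans (all-unique refl i (subst (d ~_) (periodic i) a) (subst (d ~_) (periodic (2 + i)) b)) (≡-sym (periodic (1 + i)))

      -- Only the first good vertex comes with a remote neighbour. In length 5 `all-unique` makes up
      -- for this; otherwise `Witness` is vacuous.
      noClones : ∀ k {v} → Good (window k) v → NoClones (window k)
      noClones k good with ℓ ℕ.≟ 5
      ... | no ℓ≢5 = good⇒noClones (window k) good λ ℓ≡5 → ⊥-elim (ℓ≢5 ℓ≡5)
      ... | yes ℓ≡5 = record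
        { unique-l₂ = all-unique ℓ≡5 k ; unique-l₁ = all-unique ℓ≡5 (1 + k) ; unique-o = all-unique ℓ≡5 (2 + k)
        ; unique-r₁ = all-unique ℓ≡5 (3 + k) ; unique-r₂ = all-unique ℓ≡5 (4 + k) }

      next-good : ∀ k {v} → Good (window k) v → ∀ {w} → w ~ at (4 + k) → w ≢ at (3 + k) → w ≢ at (5 + k) → Good (window (suc k)) w
      next-good k good w~r₁ w≢o w≢r₂ = record
        { p~o = w~r₁ ; p≁l₂ = v≁l₁ w~r₁ w≢o w≢r₂ ; p≁r₂ = v≁r₃ w~r₁ w≢o w≢r₂
        ; only-l = pendant-only-l w~r₁ w≢o w≢r₂ ; only-r = pendant-only-r w~r₁ w≢o w≢r₂ }
        where open Propagate (window k) good (noClones k good)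

      goods : ∀ k → ∃ (Good (window k))
      goods zero = p , initial
      goods (suc k) =
        let w , w~r₁ , _ , w≢o , w≢r₂ = avoid₁ {λ _ → ⊥} (λ _ → no id) (λ _ _ _ ()) (at (4 + k)) (at (3 + k)) (at (5 + k))
        in w , next-good k (proj₂ (goods k)) w~r₁ w≢o w≢r₂

      -- The shift by 3 turns index k into the centre of window k, so that 1 + k is its r₁, the
      -- vertex treated by `Propagate`.
      far⇒cloneFree : CloneFree (shift₁ (shift₁ (shift₁ C)))
      far⇒cloneFree = record
        { unique = λ k → NoClones.unique-r₁ (noClones k (proj₂ (goods k)))
        ; only-l = λ k a b c → Good.only-l (next-good k (proj₂ (goods k)) a b c)
        ; only-r = λ k a b c → Good.only-r (next-good k (proj₂ (goods k)) a b c)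
        ; codegree = λ k → Propagate.r₁-codegree (window k) (proj₂ (goods k)) (noClones k (proj₂ (goods k))) }

  -- Construction of an induced sun.

  module SunConstruction {ℓ : ℕ} (C : ShortestOddCycle ℓ) (cloneFree : CloneFree C) where
    open CloneFree cloneFree
    open ShortestOddCycle C
    open ShortestOddCycle (shift₁ C) using () renaming (at to s; step to s-step; periodic to s-periodic)
    open Arcs (shift₁ C)

    -- Since `s j` is `at (1 + j)`, its neighbours on the cycle are `at j` and `at (2 + j)`, without
    -- subtraction at j = 0.
    Pendant : ℕ → V → Set
    Pendant j v = v ~ s j × v ≢ at j × v ≢ at (2 + j)

    -- One arc has length 2, and v is its middle vertex for lack of clones. It is named from both
    -- ends, to contradict either pendant condition.
    shared : ∀ d e j {v} → suc d + suc e ≡ ℓ → v ~ s j → v ~ s (suc d + j) →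
      (v ≡ at (2 + j) × v ≡ at (suc d + j)) ⊎ (v ≡ at (2 + (suc d + j)) × v ≡ at j)
    shared d e j {v} eq a b with joined₂ d e j eq a b
    ... | inj₁ refl = inj₁ (v≡ , v≡)
      where
      v≡ : v ≡ at (2 + j)
      v≡ = unique (1 + j) a b
    ... | inj₂ refl = inj₂ (v≡ , trans v≡ (trans (cong at (trans (cong (λ x → suc (suc (suc x))) (+-comm d j)) lemma)) (periodic j)))
      where
      lemma : 3 + (j + d) ≡ ℓ + j
      lemma = trans (cong (3 +_) (+-comm j d)) (cong (_+ j) (trans (cong suc (+-comm 2 d)) eq))
      v≡ : v ≡ at (2 + (suc d + j))
      v≡ = unique (1 + (suc d + j)) b (subst (v ~_) (≡-sym (around (suc d) 2 j eq)) a)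

    foreign : ∀ d e j {v} → suc d + suc e ≡ ℓ → Pendant j v → ¬ v ~ s (suc d + j)
    foreign d e j eq (a , ≢l , ≢r) b with shared d e j eq a b
    ... | inj₁ (v≡ , _) = ≢r v≡
    ... | inj₂ (_ , v≡) = ≢l v≡

    foreign′ : ∀ d e j {v} → suc d + suc e ≡ ℓ → Pendant (suc d + j) v → ¬ v ~ s j
    foreign′ d e j eq (b , ≢l , ≢r) a with shared d e j eq a b
    ... | inj₁ (_ , v≡) = ≢l v≡
    ... | inj₂ (v≡ , _) = ≢r v≡

    -- One of the arcs between the j-th and the k-th cycle vertex has length 3.
    Conflict : ℕ → ℕ → Set
    Conflict j k = k ≡ 3 + j ⊎ 3 + k ≡ ℓ + j

    -- An arc has length 1 or 3; `only-r` excludes length 1.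
    pendants-adjacent : ∀ d e j {u v} → suc d + suc e ≡ ℓ → Pendant j u → Pendant (suc d + j) v → u ~ v → Conflict j (suc d + j)
    pendants-adjacent d e j {u} {v} eq (a , ≢l , ≢r) (b , ≢l′ , ≢r′) u~v with joined₃ d e j eq a u~v b
    ... | inj₁ (inj₁ refl) = ⊥-elim (≢l′ (only-r j a ≢l ≢r (~-sym u~v) b))
    ... | inj₁ (inj₂ refl) = inj₁ refl
    ... | inj₂ (inj₁ refl) = ⊥-elim (≢l (trans (only-r (suc d + j) b ≢l′ ≢r′ u~v (subst (u ~_) (≡-sym (around (suc d) 1 j eq)) a)) last))
      where
      last : at (1 + (suc d + j)) ≡ at j
      last = trans (cong at (cong (_+ j) (trans (+-comm 1 (suc d)) eq))) (periodic j)
    ... | inj₂ (inj₂ refl) = inj₂ (trans (≡-sym (+-assoc 3 (suc d) j)) (cong (_+ j) (trans (+-comm 3 (suc d)) eq)))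

    foreign-later : ∀ {j k v} → j < k → k < ℓ → Pendant j v → ¬ v ~ s k
    foreign-later {j} j<k k<ℓ pendant with gap j<k k<ℓ
    ... | d , e , refl , eq = foreign d e j eq pendant

    foreign-earlier : ∀ {j k v} → j < k → k < ℓ → Pendant k v → ¬ v ~ s j
    foreign-earlier {j} j<k k<ℓ pendant with gap j<k k<ℓ
    ... | d , e , refl , eq = foreign′ d e j eq pendant

    Pendants : ℕ → (ℕ → V) → Set
    Pendants m p = (∀ {j} → j < m → Pendant j (p j)) × (∀ {j k} → j < k → k < m → Conflict j k → ¬ p k ~ p j)

    -- Greedy choice: the m-th pendant conflicts only with those of index m ∸ 3 and 3 + m ∸ ℓ, and
    -- each of these excludes at most two vertices.
    pendants : ∀ m → m ≤ ℓ → ∃ (Pendants m)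
    pendants zero _ = at , (λ ()) , λ _ ()
    pendants (suc m) m<ℓ = extend (pendants m (ℕₚ.<⇒≤ m<ℓ))
      where
      Blocked : V → V → Set
      -- Including the hypothesis of `codegree` bounds the set for every g, also where truncated
      -- subtraction gives an irrelevant index.
      Blocked g x = x ~ s m × x ~ g × ¬ g ~ at m
      blocked? : ∀ g → Decidable (Blocked g)
      blocked? g x = (x ~? s m) ×-dec (x ~? g) ×-dec ¬? (g ~? at m)
      blocked≤2 : ∀ g → AtMostTwo (Blocked g)
      blocked≤2 g x y z (a , a′ , free) (b , b′ , _) (c , c′ , _) = codegree m free x y z (a , a′) (b , b′) (c , c′)
      extend : ∃ (Pendants m) → ∃ (Pendants (suc m))
      extend (p , attached , apart) = add
        (avoid (blocked? (p (m ∸ 3))) (blocked? (p (3 + m ∸ ℓ))) (blocked≤2 _) (blocked≤2 _) (s m) (at m) (at (2 + m)))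
        where
        add : (∃ λ x → x ~ s m × ¬ Blocked (p (m ∸ 3)) x × ¬ Blocked (p (3 + m ∸ ℓ)) x × x ≢ at m × x ≢ at (2 + m)) → ∃ (Pendants (suc m))
        add (x , x~s , free₁ , free₂ , x≢l , x≢r) = p′ , attached′ , apart′
          where
          p′ : ℕ → V
          p′ j with j ℕ.≟ m
          ... | yes _ = x
          ... | no _ = p j
          old : ∀ {j} → j < m → p′ j ≡ p j
          old {j} j<m with j ℕ.≟ m
          ... | yes refl = ⊥-elim (ℕₚ.<-irrefl refl j<m)
          ... | no _ = refl
          new : p′ m ≡ x
          new with m ℕ.≟ m
          ... | yes _ = refl
          ... | no m≢m = ⊥-elim (m≢m refl)
          attached′ : ∀ {j} → j < suc m → Pendant j (p′ j)
          attached′ {j} j<1+m with ℕₚ.m<1+n⇒m<n∨m≡n j<1+m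
          ... | inj₁ j<m rewrite old j<m = attached j<m
          ... | inj₂ refl rewrite new = x~s , x≢l , x≢r
          apart-new : ∀ {j} → j < m → Conflict j m → ¬ x ~ p j
          apart-new {j} j<m (inj₁ refl) x~p = free₁ (x~s , x~p , foreign-later (ℕₚ.m<n+m j (s≤s z≤n)) (ℕₚ.<⇒≤ m<ℓ) (attached j<m))
          apart-new {j} j<m (inj₂ eq) x~p = subst (λ i → ¬ Blocked (p i) x) (trans (cong (_∸ ℓ) eq) (m+n∸m≡n ℓ j)) free₂
            -- By periodicity `s j` is `at (4 + m)`, which has no common neighbour with `at m`.
            (x~s , x~p , λ p~m → Arcs.apart₄ C m p~m (subst (p j ~_) (≡-sym (trans (cong s eq) (s-periodic j))) (proj₁ (attached j<m))))
          apart′ : ∀ {j k} → j < k → k < suc m → Conflict j k → ¬ p′ k ~ p′ j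
          apart′ {j} {k} j<k k<1+m conflict with ℕₚ.m<1+n⇒m<n∨m≡n k<1+m
          ... | inj₁ k<m rewrite old k<m | old (ℕₚ.<-trans j<k k<m) = apart j<k k<m conflict
          ... | inj₂ refl rewrite new | old j<k = apart-new j<k conflict

    next? : ∀ i j → i < j → j < ℓ → s i ~ s j → j ≡ suc i ⊎ (i ≡ 0 × suc j ≡ ℓ)
    next? i j i<j j<ℓ a with gap i<j j<ℓ
    ... | d , e , refl , eq with joined₁ d e i eq a
    ...   | inj₁ refl = inj₁ refl
    ...   | inj₂ refl = inj₂ (i≡0 , trans (cong (2 +_) (trans (cong (d +_) i≡0) (+-identityʳ d))) eq′)
      where
      eq′ : 2 + d ≡ ℓ
      eq′ = trans (+-comm 1 (suc d)) eq
      i≡0 : i ≡ 0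
      i≡0 = ℕₚ.n≤0⇒n≡0 (+-cancelˡ-≤ (2 + d) i 0 (subst (2 + d + i ≤_) (≡-sym (trans (+-identityʳ (2 + d)) eq′)) j<ℓ))

    module Sun (p : ℕ → V) (pendantsℓ : Pendants ℓ p) where

      pendant : ∀ (j : Fin ℓ) → Pendant (toℕ j) (p (toℕ j))
      pendant j = proj₁ pendantsℓ (toℕ<n j)

      place : Fin ℓ ⊎ Fin ℓ → V
      place (inj₁ i) = s (toℕ i)
      place (inj₂ j) = p (toℕ j)

      adj-≡ : ∀ {u v} b → (u ~ v → T b) → (T b → u ~ v) → adj G u v ≡ b
      adj-≡ true _ from = adjacent (from _)
      adj-≡ false to _ = Bool.¬-not (to ∘ edge)

      Next : ℕ → ℕ → Set
      Next i j = j ≡ suc i ⊎ (i ≡ ℓ ∸ 1 × j ≡ 0)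

      toStep : ∀ (i j : Fin ℓ) → Next (toℕ i) (toℕ j) → T (cycStep ℓ i j)
      toStep i j (inj₁ eq) = Equivalence.from Bool.T-∨ (inj₁ (ℕₚ.≡⇒≡ᵇ (toℕ j) (suc (toℕ i)) eq))
      toStep i j (inj₂ (eq , eq′)) = Equivalence.from (Bool.T-∨ {toℕ j ≡ᵇ suc (toℕ i)})
        (inj₂ (Equivalence.from Bool.T-∧ (ℕₚ.≡⇒≡ᵇ (toℕ i) (ℓ ∸ 1) eq , ℕₚ.≡⇒≡ᵇ (toℕ j) 0 eq′)))

      fromStep : ∀ (i j : Fin ℓ) → T (cycStep ℓ i j) → Next (toℕ i) (toℕ j)
      fromStep i j t with Equivalence.to (Bool.T-∨ {toℕ j ≡ᵇ suc (toℕ i)}) t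
      ... | inj₁ t₁ = inj₁ (ℕₚ.≡ᵇ⇒≡ (toℕ j) (suc (toℕ i)) t₁)
      ... | inj₂ t₂ with Equivalence.to (Bool.T-∧ {toℕ i ≡ᵇ (ℓ ∸ 1)}) t₂
      ...   | t₃ , t₄ = inj₂ (ℕₚ.≡ᵇ⇒≡ (toℕ i) (ℓ ∸ 1) t₃ , ℕₚ.≡ᵇ⇒≡ (toℕ j) 0 t₄)

      next-adjacent : ∀ {i j} → Next i j → s i ~ s j
      next-adjacent {i} (inj₁ refl) = s-step i
      next-adjacent (inj₂ (refl , refl)) = subst (s (ℓ ∸ 1) ~_)
        (trans (cong s (trans (m+[n∸m]≡n {1} (≤-trans (s≤s z≤n) 5≤ℓ)) (≡-sym (+-identityʳ ℓ)))) (s-periodic 0)) (s-step (ℓ ∸ 1))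

      adjacent-next : ∀ {i j} → i < j → j < ℓ → s i ~ s j → Next i j ⊎ Next j i
      adjacent-next i<j j<ℓ a with next? _ _ i<j j<ℓ a
      ... | inj₁ eq = inj₁ (inj₁ eq)
      ... | inj₂ (eq , refl) = inj₂ (inj₂ (refl , eq))

      neighbours : ∀ (i j : Fin ℓ) → s (toℕ i) ~ s (toℕ j) → Next (toℕ i) (toℕ j) ⊎ Next (toℕ j) (toℕ i)
      neighbours i j a with <-cmp (toℕ i) (toℕ j)
      ... | tri< i<j _ _ = adjacent-next i<j (toℕ<n j) a
      ... | tri≈ _ i≡j _ = ⊥-elim (~⇒≢ a (cong s i≡j))
      ... | tri> _ _ j<i = Sum.swap (adjacent-next j<i (toℕ<n i) (~-sym a))

      cycle-adjacency : ∀ (i j : Fin ℓ) → adj G (s (toℕ i)) (s (toℕ j)) ≡ cycAdj ℓ i j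
      cycle-adjacency i j = adj-≡ (cycAdj ℓ i j)
        (λ a → Equivalence.from (Bool.T-∨ {cycStep ℓ i j}) ([ inj₁ ∘ toStep i j , inj₂ ∘ toStep j i ] (neighbours i j a)))
        (λ t → [ next-adjacent ∘ fromStep i j , ~-sym ∘ next-adjacent ∘ fromStep j i ] (Equivalence.to (Bool.T-∨ {cycStep ℓ i j}) t))

      attached-only : ∀ (j i : Fin ℓ) → p (toℕ j) ~ s (toℕ i) → toℕ j ≡ toℕ i
      attached-only j i a with <-cmp (toℕ j) (toℕ i)
      ... | tri< j<i _ _ = ⊥-elim (foreign-later j<i (toℕ<n i) (pendant j) a)
      ... | tri≈ _ j≡i _ = j≡i
      ... | tri> _ _ i<j = ⊥-elim (foreign-earlier i<j (toℕ<n j) (pendant j) a)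

      pendant-adjacency : ∀ (j i : Fin ℓ) → adj G (p (toℕ j)) (s (toℕ i)) ≡ (toℕ j ≡ᵇ toℕ i)
      pendant-adjacency j i = adj-≡ (toℕ j ≡ᵇ toℕ i) (ℕₚ.≡⇒≡ᵇ (toℕ j) (toℕ i) ∘ attached-only j i)
        λ t → subst (λ k → p (toℕ j) ~ s k) (ℕₚ.≡ᵇ⇒≡ (toℕ j) (toℕ i) t) (proj₁ (pendant j))

      pendants-apart : ∀ {j k} → j < k → k < ℓ → ¬ p k ~ p j
      pendants-apart {j} {k} j<k k<ℓ a = proj₂ pendantsℓ j<k k<ℓ (conflict (gap j<k k<ℓ)) a
        where
        conflict : (∃₂ λ d e → k ≡ suc d + j × suc d + suc e ≡ ℓ) → Conflict j k
        conflict (d , e , refl , eq) = pendants-adjacent d e j eq (proj₁ pendantsℓ (ℕₚ.<-trans j<k k<ℓ)) (proj₁ pendantsℓ k<ℓ) (~-sym a)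

      ≡ᵇ-sym : ∀ i j → (i ≡ᵇ j) ≡ (j ≡ᵇ i)
      ≡ᵇ-sym zero zero = refl
      ≡ᵇ-sym zero (suc j) = refl
      ≡ᵇ-sym (suc i) zero = refl
      ≡ᵇ-sym (suc i) (suc j) = ≡ᵇ-sym i j

      adjacency : ∀ x y → adj G (place x) (place y) ≡ sunAdj ℓ x y
      adjacency (inj₁ i) (inj₁ j) = cycle-adjacency i j
      adjacency (inj₁ i) (inj₂ j) = trans (Graph.sym G _ _) (trans (pendant-adjacency j i) (≡ᵇ-sym (toℕ j) (toℕ i)))
      adjacency (inj₂ i) (inj₁ j) = pendant-adjacency i j
      adjacency (inj₂ i) (inj₂ j) = adj-≡ false apart λ ()
        where
        apart : ¬ p (toℕ i) ~ p (toℕ j)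
        apart a with <-cmp (toℕ i) (toℕ j)
        ... | tri< i<j _ _ = pendants-apart i<j (toℕ<n j) (~-sym a)
        ... | tri≈ _ i≡j _ = ~⇒≢ a (cong p i≡j)
        ... | tri> _ _ j<i = pendants-apart j<i (toℕ<n i) a

      distinct-s : ∀ {i j} → i < j → j < ℓ → s i ≢ s j
      distinct-s {i} i<j j<ℓ same with gap i<j j<ℓ
      ... | d , e , refl , eq = not-joined₀ d e i eq same

      -- If they were equal, `s i` would be adjacent to `s j`, hence one of its two cycle
      -- neighbours, which `Pendant` excludes.
      s≢p : ∀ (i j : Fin ℓ) → s (toℕ i) ≢ p (toℕ j)
      s≢p i j same = clash (neighbours i j (subst (_~ s (toℕ j)) (≡-sym same) (proj₁ (pendant j))))
        where
        1+[ℓ∸1] : 1 + (ℓ ∸ 1) ≡ ℓ + 0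
        1+[ℓ∸1] = trans (m+[n∸m]≡n {1} (≤-trans (s≤s z≤n) 5≤ℓ)) (≡-sym (+-identityʳ ℓ))
        clash : ¬ (Next (toℕ i) (toℕ j) ⊎ Next (toℕ j) (toℕ i))
        clash (inj₁ (inj₁ j≡1+i)) = proj₁ (proj₂ (pendant j)) (trans (≡-sym same) (cong at (≡-sym j≡1+i)))
        clash (inj₁ (inj₂ (i≡ , j≡0))) = proj₁ (proj₂ (pendant j)) (trans (≡-sym same)
          (trans (cong at (trans (cong suc i≡) 1+[ℓ∸1])) (trans (periodic 0) (cong at (≡-sym j≡0)))))
        clash (inj₂ (inj₁ i≡1+j)) = proj₂ (proj₂ (pendant j)) (trans (≡-sym same) (cong s i≡1+j))
        clash (inj₂ (inj₂ (j≡ , i≡0))) = proj₂ (proj₂ (pendant j)) (trans (≡-sym same)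
          (trans (cong s i≡0) (≡-sym (trans (cong s (trans (cong suc j≡) 1+[ℓ∸1])) (s-periodic 0)))))

      injective : ∀ {x y} → place x ≡ place y → x ≡ y
      injective {inj₁ i} {inj₁ j} same with <-cmp (toℕ i) (toℕ j)
      ... | tri< i<j _ _ = ⊥-elim (distinct-s i<j (toℕ<n j) same)
      ... | tri≈ _ i≡j _ = cong inj₁ (toℕ-injective i≡j)
      ... | tri> _ _ j<i = ⊥-elim (distinct-s j<i (toℕ<n i) (≡-sym same))
      injective {inj₁ i} {inj₂ j} same = ⊥-elim (s≢p i j same)
      injective {inj₂ i} {inj₁ j} same = ⊥-elim (s≢p j i (≡-sym same))
      injective {inj₂ i} {inj₂ j} same = cong inj₂ (toℕ-injective (attached-only i j (subst (_~ s (toℕ j)) (≡-sym same) (proj₁ (pendant j)))))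

    contains-sun : ContainsInduced (sunAdj ℓ) G
    contains-sun = place , injective , adjacency
      where open Sun (proj₁ (pendants ℓ ℕₚ.≤-refl)) (proj₂ (pendants ℓ ℕₚ.≤-refl))

-- Colouring the surroundings of a shortest odd cycle.

module CycleNeighbourhood {n : ℕ} (G : Graph n) (critical : Adjacency.Critical G)
  (sunFree : ∀ t → 5 ≤ t → SunFree t G) where

  open OddCycles G critical public

  neighbourhood : V → StableSet
  neighbourhood v = record { member = _~ v ; stable = tri′ }

  far-excluded : ∀ {ℓ} (C : ShortestOddCycle ℓ) → let open ShortestOddCycle C in
    ∀ {z p} i → FarFrom C z → z ~ p → ¬ p ~ at i
  far-excluded {ℓ} C {z} {p} i far z~p p~i = sunFree ℓ 5≤ℓ (SunConstruction.contains-sun _ cloneFree)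
    where
    open ShortestOddCycle C
    s : ℕ
    -- Moves `at i` to position 3, the centre of the initial window.
    s = (ℓ ∸ 3) + i
    at-3+s : at (3 + s) ≡ at i
    at-3+s = trans (cong at (trans (≡-sym (+-assoc 3 (ℓ ∸ 3) i)) (cong (_+ i) (m+[n∸m]≡n (≤-trans (≤ᵇ⇒≤ 3 5 tt) 5≤ℓ))))) (periodic i)
    cloneFree : CloneFree (shift₁ (shift₁ (shift₁ (shift s C))))
    cloneFree = far⇒cloneFree (shift s C) (λ j → far (j + s)) z~p (subst (p ~_) (≡-sym at-3+s) p~i)

  module _ {ℓ : ℕ} (C : ShortestOddCycle ℓ) where
    open ShortestOddCycle C
    open Arcs C

    Near : V → Set
    Near v = ∃ λ (i : Fin ℓ) → v ~ at (toℕ i)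

    Near? : Decidable Near
    Near? v = any? λ i → v ~? at (toℕ i)

    reduce : ∀ i → ∃ λ (r : Fin ℓ) → ∀ k → at (k + i) ≡ at (k + toℕ r)
    reduce i = fromℕ< (m%n<n i ℓ) , λ k → trans (cong (λ j → at (k + j)) (m≡m%n+[m/n]*n i ℓ))
      (trans (multiple (i / ℓ) k (i % ℓ)) (cong (λ j → at (k + j)) (≡-sym (toℕ-fromℕ< (m%n<n i ℓ)))))
      where
      instance
        nonZero : NonZero ℓ
        nonZero = >-nonZero (≤-trans (s≤s z≤n) 5≤ℓ)
      multiple : ∀ q k r → at (k + (r + q * ℓ)) ≡ at (k + r)
      multiple zero k r = cong (λ j → at (k + j)) (+-identityʳ r)
      multiple (suc q) k r = trans (cong at rearrange) (trans (periodic _) (multiple q k r))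
        where
        rearrange : k + (r + (ℓ + q * ℓ)) ≡ ℓ + (k + (r + q * ℓ))
        rearrange = trans (≡-sym (+-assoc k r _)) (trans (≡-sym (+-assoc (k + r) ℓ _))
          (trans (cong (_+ q * ℓ) (+-comm (k + r) ℓ)) (trans (+-assoc ℓ (k + r) _) (cong (ℓ +_) (+-assoc k r _)))))

    near : ∀ i {v} → v ~ at i → Near v
    near i {v} v~i with reduce i
    ... | r , same = r , subst (v ~_) (same 0) v~i

    -- An edge between neighbours of `at i` and `at j` forces an arc of length 1 or 3. The arc from
    -- i to j is even, and the one through 0, 1, 2 has length at least 4.
    tail : Bool → StableSet
    tail b = record { member = member ; stable = stable }
      where
      member : V → Set
      member v = ∃ λ (i : Fin ℓ) → 3 ≤ toℕ i × odd (toℕ i) ≡ b × v ~ at (toℕ i)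
      same-parity : ∀ i j → odd i ≡ b → odd j ≡ b → odd j ≢ not (odd i)
      same-parity i j refl eq = Bool.not-¬ eq
      too-long : ∀ d e {i} → 3 ≤ i → suc d + i < ℓ → suc d + suc e ≡ ℓ → 3 ≤ e
      too-long d e {i} 3≤i j<ℓ eq = ≤-trans 3≤i (ℕₚ.≤-pred (+-cancelˡ-≤ (suc d) (suc i) (suc e)
        (subst (_≤ suc d + suc e) (≡-sym (+-suc (suc d) i)) (subst (suc (suc d + i) ≤_) (≡-sym eq) j<ℓ))))
      separate : ∀ {i j u v} → i < j → j < ℓ → 3 ≤ i → odd i ≡ b → odd j ≡ b → u ~ at i → v ~ at j → ¬ u ~ v
      separate {i} {j} i<j j<ℓ 3≤i oi oj u~i v~j u~v with gap i<j j<ℓ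
      ... | d , e , refl , eq with joined₃ d e i eq u~i u~v v~j
      ...   | inj₁ (inj₁ refl) = same-parity i (suc i) oi oj refl
      ...   | inj₁ (inj₂ refl) = same-parity i (3 + i) oi oj (Bool.not-involutive (not (odd i)))
      ...   | inj₂ (inj₁ refl) = ℕₚ.<⇒≱ (s≤s z≤n) (too-long d e 3≤i j<ℓ eq)
      ...   | inj₂ (inj₂ refl) = ℕₚ.<⇒≱ (s≤s (s≤s (s≤s z≤n))) (too-long d e 3≤i j<ℓ eq)
      stable : ∀ {u v} → member u → member v → ¬ u ~ v
      stable (i , 3≤i , oi , u~i) (j , 3≤j , oj , v~j) u~v with <-cmp (toℕ i) (toℕ j)
      ... | tri< i<j _ _ = separate i<j (toℕ<n j) 3≤i oi oj u~i v~j u~v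
      ... | tri≈ _ i≡j _ = tri′ u~i (subst (λ k → _ ~ at k) (≡-sym i≡j) v~j) u~v
      ... | tri> _ _ j<i = separate j<i (toℕ<n i) 3≤j oj oi v~j u~i (~-sym u~v)

    nearClasses : List StableSet
    nearClasses = neighbourhood (at 0) ∷ neighbourhood (at 1) ∷ neighbourhood (at 2) ∷ tail false ∷ tail true ∷ []

    near-covered : ∀ {v} → Near v → Any (λ S → StableSet.member S v) nearClasses
    near-covered (i , v~i) = position (toℕ i) refl v~i
      where
      position : ∀ k → k ≡ toℕ i → _ ~ at k → Any (λ S → StableSet.member S _) nearClasses
      position 0 _ a = here a
      position 1 _ a = there (here a)
      position 2 _ a = there (there (here a))
      position (suc (suc (suc k))) eq a with odd (toℕ i) in parity
      ... | false = there (there (there (here (i , subst (3 ≤_) eq (s≤s (s≤s (s≤s z≤n))) , parity , v~i))))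
      ... | true = there (there (there (there (here (i , subst (3 ≤_) eq (s≤s (s≤s (s≤s z≤n))) , parity , v~i)))))

    -- As z has no neighbour on the cycle, d is a clone of `at (1 + i)` different from it.
    CloneNeighbour : ℕ → V → Set
    CloneNeighbour i z = ¬ Near z × ∃ λ d → d ~ at i × d ~ at (2 + i) × z ~ d

    cloneNeighbour? : ∀ i → Decidable (CloneNeighbour i)
    cloneNeighbour? i z = ¬? (Near? z) ×-dec any? λ d → (d ~? at i) ×-dec (d ~? at (2 + i)) ×-dec (z ~? d)

    cloneNeighbour-exists : ∀ {z p} → ¬ Near z → z ~ p → Near p → ∃ λ (i : Fin ℓ) → CloneNeighbour (toℕ i) z
    cloneNeighbour-exists {z} {p} far z~p (j , p~j) = decidable-stable (any? λ i → cloneNeighbour? (toℕ i) z) λ none →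
      far-excluded C (toℕ j) (farFrom none) z~p p~j
      where
      farFrom : ¬ (∃ λ (i : Fin ℓ) → CloneNeighbour (toℕ i) z) → FarFrom C z
      farFrom none i {d} a b z~d with reduce i
      ... | r , same = none (r , far , d , subst (d ~_) (same 0) a , subst (d ~_) (same 2) b , z~d)

    -- With m one step before i, the 4-cycle through d and `at (2 + m)` with pendants `at m`, z,
    -- `at (4 + m)` is a sunspot unless `at m` and `at (4 + m)` are adjacent.
    cloneNeighbour⇒pentagon : ∀ i {z} → CloneNeighbour i z → ℓ ≡ 5
    cloneNeighbour⇒pentagon i {z} (far , d , d~i , d~2+i , z~d) =
      pentagon (step m) (step (1 + m)) (step (2 + m)) (step (3 + m)) (~-sym (~-stable λ chord →
        spot (~-sym d~1+m) d~3+m (~-sym (step (2 + m))) (~-sym (step (1 + m))) (step m) z~d (~-sym (step (3 + m)))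
          (no-chord₃ m) (far ∘ near (2 + m)) (no-chord₃ (1 + m) ∘ ~-sym) (far ∘ near m ∘ ~-sym) (far ∘ near (4 + m)) chord))
      where
      m : ℕ
      m = (ℓ ∸ 1) + i
      1+m : suc m ≡ ℓ + i
      1+m = cong (_+ i) (m+[n∸m]≡n {1} (≤-trans (s≤s z≤n) 5≤ℓ))
      d~1+m : d ~ at (1 + m)
      d~1+m = subst (d ~_) (≡-sym (trans (cong at 1+m) (periodic i))) d~i
      d~3+m : d ~ at (3 + m)
      d~3+m = subst (d ~_) (≡-sym (trans (cong at (trans (cong (2 +_) 1+m) (2+ℓ+i ℓ))) (periodic (2 + i)))) d~2+i
        where
        2+ℓ+i : ∀ x → 2 + (x + i) ≡ x + (2 + i)
        2+ℓ+i x = trans (≡-sym (+-assoc 2 x i)) (trans (cong (_+ i) (+-comm 2 x)) (+-assoc x 2 i))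

    near-closed : ℓ ≢ 5 → Closed Near
    near-closed ℓ≢5 {u} {v} u~v near-u = decidable-stable (Near? v) λ far →
      let i , clone = cloneNeighbour-exists far (~-sym u~v) near-u in ℓ≢5 (cloneNeighbour⇒pentagon (toℕ i) clone)

    -- Otherwise z, `at (3 + i)` and z′ are the pendants of a sunspot on w, `at (2 + i)`, w′,
    -- `at i`.
    clone-traces-cross : ∀ i {z z′ w w′} → ¬ Near z → ¬ Near z′ → w ~ at i → w ~ at (2 + i) → w′ ~ at i → w′ ~ at (2 + i) →
      z ~ w → ¬ z ~ w′ → z′ ~ w′ → ¬ z′ ~ w → z ~ z′
    clone-traces-cross i far far′ w~i w~2+i w′~i w′~2+i z~w z≁w′ z′~w′ z′≁w = ~-stable λ z≁z′ →
      spot w~2+i (~-sym w′~2+i) w′~i (~-sym w~i) z~w (~-sym (step (2 + i))) z′~w′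
        z≁w′ (no-chord₃ i ∘ ~-sym) z′≁w (far ∘ near (3 + i)) (far′ ∘ near (3 + i) ∘ ~-sym) z≁z′

    record ThreeClasses (P : V → Set) : Set₁ where
      field
        S₁ S₂ S₃ : StableSet
        covered : ∀ {z} → P z → Any (λ S → StableSet.member S z) (S₁ ∷ S₂ ∷ S₃ ∷ [])

    -- Nonadjacent vertices of CloneNeighbour i have nested traces on the clones.
    cloneNeighbour-classes : ∀ i → ThreeClasses (CloneNeighbour i)
    cloneNeighbour-classes i = split (any? λ z₁ → any? λ z₂ → cloneNeighbour? i z₁ ×-dec cloneNeighbour? i z₂ ×-dec (z₁ ~? z₂))
      where
      split : Dec (∃₂ λ z₁ z₂ → CloneNeighbour i z₁ × CloneNeighbour i z₂ × z₁ ~ z₂) → ThreeClasses (CloneNeighbour i)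
      split (no none) = record { S₁ = whole ; S₂ = whole ; S₃ = whole ; covered = here }
        where
        whole : StableSet
        whole = record { member = CloneNeighbour i ; stable = λ {u} {v} cu cv u~v → none (u , v , cu , cv , u~v) }
      split (yes (z₁ , z₂ , (far₁ , w₁ , w₁~i , w₁~2+i , z₁~w₁) , (far₂ , w₂ , w₂~i , w₂~2+i , z₂~w₂) , z₁~z₂)) = record
        { S₁ = neighbourhood z₁ ; S₂ = neighbourhood z₂ ; S₃ = neighbourhood w₁ ; covered = covered }
        where
        covered : ∀ {z} → CloneNeighbour i z → Any (λ S → StableSet.member S z) (neighbourhood z₁ ∷ neighbourhood z₂ ∷ neighbourhood w₁ ∷ [])
        covered {z} (far , w , w~i , w~2+i , z~w) with z ~? z₁ | z ~? z₂ | z ~? w₁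
        ... | yes a | _ | _ = here a
        ... | no _ | yes a | _ = there (here a)
        ... | no _ | no _ | yes a = there (there (here a))
        -- Traces of z and z₁ are nested and z misses w₁, so z₁ ~ w and hence z₂ ≁ w. By nesting
        -- with z₂, z ~ w₂, and so z₁ ~ w₂: a triangle with z₂.
        ... | no z≁z₁ | no z≁z₂ | no z≁w₁ = ⊥-elim (tri (~-sym z₁~w₂) z₁~z₂ (~-sym z₂~w₂))
          where
          z₁~w : z₁ ~ w
          z₁~w = ~-stable λ z₁≁w → z≁z₁ (clone-traces-cross i far far₁ w~i w~2+i w₁~i w₁~2+i z~w z≁w₁ z₁~w₁ z₁≁w)
          z~w₂ : z ~ w₂
          z~w₂ = ~-stable λ z≁w₂ → z≁z₂ (clone-traces-cross i far far₂ w~i w~2+i w₂~i w₂~2+i z~w z≁w₂ z₂~w₂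
            (λ z₂~w → tri z₁~z₂ z₂~w z₁~w))
          z₁~w₂ : z₁ ~ w₂
          z₁~w₂ = ~-stable λ z₁≁w₂ → z≁z₁ (clone-traces-cross i far far₁ w₂~i w₂~2+i w₁~i w₁~2+i z~w₂ z≁w₁ z₁~w₁ z₁≁w₂)

  module _ (C : ShortestOddCycle 5) where
    open ShortestOddCycle C

    Within₂ : V → Set
    Within₂ v = Near C v ⊎ (∃ λ u → Near C u × v ~ u)

    within₂? : Decidable Within₂
    within₂? v = Near? C v ⊎-dec any? λ u → Near? C u ×-dec (v ~? u)

    -- The pentagon with `at (1 + i)` replaced by its clone d, which becomes vertex 0.
    module Replace (i : ℕ) {d : V} (d~i : d ~ at i) (d~2+i : d ~ at (2 + i)) where
      at′ : ℕ → V
      at′ 0 = d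
      at′ 1 = at (2 + i)
      at′ 2 = at (3 + i)
      at′ 3 = at (4 + i)
      at′ 4 = at (5 + i)
      at′ (suc (suc (suc (suc (suc j))))) = at′ j

      step′ : ∀ j → at′ j ~ at′ (suc j)
      step′ 0 = d~2+i
      step′ 1 = step (2 + i)
      step′ 2 = step (3 + i)
      step′ 3 = step (4 + i)
      step′ 4 = subst (_~ d) (≡-sym (periodic i)) (~-sym d~i)
      step′ (suc (suc (suc (suc (suc j))))) = step′ j

      replaced : ShortestOddCycle 5
      replaced = record { at = at′ ; step = step′ ; periodic = λ _ → refl ; odd-length = refl ; shortest = shortest ; 5≤ℓ = 5≤ℓ }

      -- Of two vertices at distance 2 on the new pentagon, at least one is not d.
      near-distance-two : ∀ j {e} → e ~ at′ j → e ~ at′ (2 + j) → Near C e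
      near-distance-two 0 _ b = near C (3 + i) b
      near-distance-two 1 a _ = near C (2 + i) a
      near-distance-two 2 a _ = near C (3 + i) a
      near-distance-two 3 a _ = near C (4 + i) a
      near-distance-two 4 a _ = near C (5 + i) a
      near-distance-two (suc (suc (suc (suc (suc j))))) a b = near-distance-two j a b

    -- If v were outside, u would be adjacent to a clone d of some cycle vertex. On the pentagon
    -- through d, u is near and v is far, against `far-excluded`.
    within₂-closed : Closed Within₂
    within₂-closed {u} {v} u~v (inj₁ near-u) = inj₂ (u , near-u , ~-sym u~v)
    within₂-closed {u} {v} u~v (inj₂ (p , near-p , u~p)) = decidable-stable (within₂? v) λ outside →
      let i , _ , d , d~i , d~2+i , u~d = cloneNeighbour-exists C (λ near-u → outside (inj₂ (u , near-u , ~-sym u~v))) u~p near-p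
      in far-excluded (Replace.replaced (toℕ i) d~i d~2+i) 0
           (λ j a b v~e → outside (inj₂ (_ , Replace.near-distance-two (toℕ i) d~i d~2+i j a b , v~e))) (~-sym u~v) u~d

    cloneClasses : Fin 5 → List StableSet
    cloneClasses i = S₁ ∷ S₂ ∷ S₃ ∷ []
      where open ThreeClasses (cloneNeighbour-classes C (toℕ i))

    within₂-classes : List StableSet
    within₂-classes = nearClasses C ++ concatMap cloneClasses (allFin 5)

    clone-covered : ∀ {z} (i : Fin 5) → CloneNeighbour C (toℕ i) z → Any (λ S → StableSet.member S z) within₂-classes
    clone-covered i clone = ++⁺ʳ (nearClasses C)
      (concatMap⁺ cloneClasses (Any.map (λ { refl → ThreeClasses.covered (cloneNeighbour-classes C (toℕ i)) clone }) (∈-allFin i)))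

    within₂-covered : ∀ {v} → Within₂ v → Any (λ S → StableSet.member S v) within₂-classes
    within₂-covered {v} within = split (Near? C v) within
      where
      split : Dec (Near C v) → Within₂ v → Any (λ S → StableSet.member S v) within₂-classes
      split (yes near-v) _ = ++⁺ˡ (near-covered C near-v)
      split (no far) (inj₁ near-v) = ⊥-elim (far near-v)
      split (no far) (inj₂ (p , near-p , v~p)) =
        let i , clone = cloneNeighbour-exists C far v~p near-p in clone-covered i clone

  cycle-component : ∀ {ℓ} → ShortestOddCycle ℓ → Component
  cycle-component {ℓ} C with ℓ ℕ.≟ 5
  ... | yes refl = record
    { member = Within₂ C ; member? = within₂? C ; closed = within₂-closed C ; root = at 0 ; root∈ = inj₁ (near C 1 (step 0))
    -- Five classes for `Near` and three for each of five indices make 20.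
    ; classes = within₂-classes C ; few = ≤ᵇ⇒≤ 20 47 tt ; covered = within₂-covered C }
    where open ShortestOddCycle C
  ... | no ℓ≢5 = record
    { member = Near C ; member? = Near? C ; closed = near-closed C ℓ≢5 ; root = at 0 ; root∈ = near C 1 (step 0)
    ; classes = nearClasses C ; few = ≤ᵇ⇒≤ 5 47 tt ; covered = near-covered C }
    where open ShortestOddCycle C

-- Periodic unrolling of closed walks, and bipartite components.

module ClosedWalks {n : ℕ} (G : Graph n) where

  open Adjacency G
  open Walks G

  module Unroll {k : ℕ} {r x : V} (e₀ : r ~ x) (w : Walk k x r) where

    -- The i-th vertex met when following the given walk to r and then going round `e₀ ∷ w` forever.
    visit : ∀ {j u} → Walk j u r → ℕ → V
    visit [] zero = r
    visit [] (suc i) = visit w i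
    visit {u = u} (e ∷ p) zero = u
    visit (e ∷ p) (suc i) = visit p i

    visit-start : ∀ {j u} (p : Walk j u r) → visit p 0 ≡ u
    visit-start [] = refl
    visit-start (e ∷ p) = refl

    visit-step : ∀ {j u} (p : Walk j u r) i → visit p i ~ visit p (suc i)
    visit-step [] zero = subst (r ~_) (≡-sym (visit-start w)) e₀
    visit-step [] (suc i) = visit-step w i
    visit-step {u = u} (e ∷ p) zero = subst (u ~_) (≡-sym (visit-start p)) e
    visit-step (e ∷ p) (suc i) = visit-step p i

    visit-end : ∀ {j u} (p : Walk j u r) i → visit p (j + i) ≡ visit [] i
    visit-end [] i = refl
    visit-end (e ∷ p) i = visit-end p i

    visit-period : ∀ i → visit (e₀ ∷ w) (suc k + i) ≡ visit (e₀ ∷ w) i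
    visit-period zero = visit-end (e₀ ∷ w) zero
    visit-period (suc i) = visit-end (e₀ ∷ w) (suc i)

  NoOddClosedWalk : ℕ → Set
  NoOddClosedWalk k = ∀ {v} → odd k ≡ true → ¬ Walk k v v

  shortestOddCycle : TriangleFree G → ∀ {k v} → odd k ≡ true → Walk k v v → (∀ {j} → j < k → NoOddClosedWalk j) → ShortestOddCycle k
  shortestOddCycle triangleFree {suc k} odd-k w@(e ∷ p) minimal = record
    { at = visit w ; step = visit-step w ; periodic = visit-period
    ; odd-length = odd-k ; shortest = λ odd-j q → ℕₚ.≮⇒≥ λ j<k → minimal j<k odd-j q ; 5≤ℓ = long odd-k w }
    where
    open Unroll e p
    long : ∀ {k v} → odd k ≡ true → Walk k v v → 5 ≤ k
    long _ (a ∷ []) = ⊥-elim (~-irrefl a)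
    long _ (a ∷ b ∷ c ∷ []) = ⊥-elim (triangleFree _ _ _ (adjacent a) (adjacent b) (adjacent (~-sym c)))
    long _ (a ∷ b ∷ c ∷ d ∷ f ∷ _) = s≤s (s≤s (s≤s (s≤s (s≤s z≤n))))
    long () []
    long () (a ∷ b ∷ [])
    long () (a ∷ b ∷ c ∷ d ∷ [])

  -- The parity classes of reachable vertices are stable, as an edge inside one closes an odd walk.
  -- Reachability is decided only under double negation, which suffices to refute the
  -- counterexample.
  bipartite-component : (∀ k → NoOddClosedWalk k) → V → ¬ ¬ Component
  bipartite-component noOdd r no-component =
    decide λ even? → decide λ odd? → no-component (component even? odd?)
    where
    Reached : Bool → V → Set
    Reached b v = ∃ λ k → odd k ≡ b × Walk k r v
    decide : ∀ {P : V → Set} → ¬ ¬ Decidable P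
    decide = sequence (RawMonad.rawApplicative ¬¬-Monad) λ _ → ¬¬-excluded-middle
    next : ∀ {b u v} → u ~ v → Reached b u → Reached (not b) v
    next {u = u} {v} u~v (k , refl , p) = suc k , refl , subst (λ j → Walk j r v) (+-comm k 1) (p ++ʷ (u~v ∷ []))
    same-parity : ∀ {b u v} → Reached b u → Reached b v → ¬ u ~ v
    same-parity {b} (j , refl , p) (k , eq , q) u~v = noOdd (j + suc k) parity (p ++ʷ (u~v ∷ reverse q))
      where
      parity : odd (j + suc k) ≡ true
      parity = trans (odd-+ j (suc k)) (trans (cong (λ x → odd j xor not x) eq) (xor-not (odd j)))
        where
        xor-not : ∀ x → x xor not x ≡ true
        xor-not true = refl
        xor-not false = refl
    component : Decidable (Reached false) → Decidable (Reached true) → Component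
    component even? odd? = record
      { member = λ v → Reached false v ⊎ Reached true v
      ; member? = λ v → even? v ⊎-dec odd? v
      ; closed = λ u~v → [ inj₂ ∘ next u~v , inj₁ ∘ next u~v ]
      ; root = r
      ; root∈ = inj₁ (0 , refl , [])
      ; classes = record { member = Reached false ; stable = same-parity }
                ∷ record { member = Reached true ; stable = same-parity } ∷ []
      ; few = ≤ᵇ⇒≤ 2 47 tt
      ; covered = [ here , there ∘ here ] }

  -- No edge leaves K, so its classes can replace c there; K contains `root`, where c may fail.
  component-colouring : (K : Component) (c : V → Fin 47) →
    (∀ {u v} → u ≢ Component.root K → v ≢ Component.root K → u ~ v → c u ≢ c v) → ChromaticAtMost G 47
  component-colouring K c proper = colour , λ u v a → proper′ (edge a)
    where
    open Component K
    class : ∀ {v} → member v → Fin 47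
    class m = inject≤ (index (covered m)) few
    same-class : ∀ {u v} (mu : member u) (mv : member v) → class mu ≡ class mv → ¬ u ~ v
    same-class {u} {v} mu mv eq = StableSet.stable (lookup classes (index (covered mu))) (lookup-index (covered mu))
      (subst (λ i → StableSet.member (lookup classes i) v) (≡-sym (inject≤-injective few few _ _ eq)) (lookup-index (covered mv)))
    colour : V → Fin 47
    colour v with member? v
    ... | yes m = class m
    ... | no _ = c v
    proper′ : ∀ {u v} → u ~ v → colour u ≢ colour v
    proper′ {u} {v} u~v with member? u | member? v
    ... | yes mu | yes mv = λ eq → same-class mu mv eq u~v
    ... | yes mu | no ¬mv = ⊥-elim (¬mv (closed u~v mu))
    ... | no ¬mu | yes mv = ⊥-elim (¬mu (closed (~-sym u~v) mv))
    ... | no ¬mu | no ¬mv = proper (λ { refl → ¬mu root∈ }) (λ { refl → ¬mv root∈ }) u~v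

-- Decidability of colourability, and the minimal counterexample.

missing-colour : ∀ {m} (ks : List (Fin m)) → length ks < m → ∃ λ k → k ∉ ks
missing-colour ks short = decidable-stable (any? λ k → ¬? (k ∈? ks)) λ none →
  let all = λ k → decidable-stable (k ∈? ks) λ k∉ → none (k , k∉)
      i , j , i<j , eq = pigeonhole short (λ k → index (all k))
  in Finₚ.<⇒≢ i<j (trans (lookup-index (all i)) (trans (cong (lookup ks) eq) (≡-sym (lookup-index (all j)))))
  where open DecMembership _≟_ using (_∈?_)

-- `resp` stands in for function extensionality when a function is rebuilt from its head and tail.
search-functions : ∀ n {m} {P : (Fin n → Fin m) → Set} → (∀ f → Dec (P f)) → (∀ {f g} → f ≗ g → P f → P g) → Dec (∃ P)
search-functions zero P? resp = map′ (_ ,_) (λ (f , Pf) → resp (λ ()) Pf) (P? λ ())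
search-functions (suc n) P? resp = map′ (λ (x , f , Pf) → x Vector.∷ f , Pf)
  (λ (f , Pf) → f zero , f ∘ suc , resp (λ { zero → refl ; (suc _) → refl }) Pf)
  (any? λ x → search-functions n (λ f → P? (x Vector.∷ f)) λ f≗g → resp λ { zero → refl ; (suc i) → f≗g i })

chromaticAtMost? : ∀ {n} (G : Graph n) k → Dec (ChromaticAtMost G k)
chromaticAtMost? {n} G k = search-functions n
  (λ c → all? λ u → all? λ v → (adj G u v Bool.≟ true) →-dec ¬? (c u ≟ c v))
  λ f≗g proper u v a gu≡gv → proper u v a (trans (f≗g u) (trans gu≡gv (≡-sym (f≗g v))))

delete : ∀ {n} → Graph (suc n) → Fin (suc n) → Graph n
delete G v = record
  { adj = λ x y → adj G (punchIn v x) (punchIn v y)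
  ; sym = λ x y → Graph.sym G (punchIn v x) (punchIn v y)
  ; irrefl = λ x → irrefl G (punchIn v x) }

undelete : ∀ {n} {V : Set} {H : V → V → Bool} (G : Graph (suc n)) v → ContainsInduced H (delete G v) → ContainsInduced H G
undelete G v (f , injective , adjacency) = punchIn v ∘ f , (λ eq → injective (punchIn-injective v _ _ eq)) , adjacency

module MinimalCounterexample {n : ℕ} (G : Graph (suc n)) (triangleFree : TriangleFree G) (sunspotFree : SunspotFree 4 G)
  (sunFree : ∀ t → 5 ≤ t → SunFree t G) (smaller : ∀ v → ChromaticAtMost (delete G v) 47) (uncolourable : ¬ ChromaticAtMost G 47) where

  open Adjacency G
  open Walks G
  open ClosedWalks G

  colour-without : V → V → Fin 47
  colour-without v u with v ≟ u
  -- An arbitrary value: properness is claimed only away from v.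
  ... | yes _ = zero
  ... | no v≢u = proj₁ (smaller v) (punchOut v≢u)

  colour-without-proper : ∀ v {x y} → x ≢ v → y ≢ v → x ~ y → colour-without v x ≢ colour-without v y
  colour-without-proper v {x} {y} x≢v y≢v x~y with v ≟ x | v ≟ y
  ... | yes v≡x | _ = ⊥-elim (x≢v (≡-sym v≡x))
  ... | no _ | yes v≡y = ⊥-elim (y≢v (≡-sym v≡y))
  ... | no v≢x | no v≢y = proj₂ (smaller v) (punchOut v≢x) (punchOut v≢y)
    (adjacent (subst₂ _~_ (≡-sym (punchIn-punchOut v≢x)) (≡-sym (punchIn-punchOut v≢y)) x~y))

  every-colour-blocked : ∀ v k → ¬ (∀ {w} → w ~ v → colour-without v w ≢ k)
  every-colour-blocked v k free = uncolourable (colour , λ x y a → proper (edge a))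
    where
    colour : V → Fin 47
    colour u with u ≟ v
    ... | yes _ = k
    ... | no _ = colour-without v u
    proper : ∀ {x y} → x ~ y → colour x ≢ colour y
    proper {x} {y} x~y with x ≟ v | y ≟ v
    ... | yes refl | yes refl = ⊥-elim (~-irrefl x~y)
    ... | yes refl | no _ = λ eq → free (~-sym x~y) (≡-sym eq)
    ... | no _ | yes refl = free x~y
    ... | no x≢v | no y≢v = colour-without-proper v x≢v y≢v x~y

  -- If N(u) lies in N(v), then u can take the colour of v. If 46 vertices include all of N(v), one
  -- of the 47 colours is free for v.
  critical : Critical
  critical = record
    { triangleFree = triangleFree
    ; sunspotFree = sunspotFree
    ; notDominated = λ {u} {v} u≢v → decidable-stable (any? λ w → (w ~? u) ×-dec ¬? (w ~? v)) λ dominated →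
        every-colour-blocked u (colour-without u v) λ {w} w~u → colour-without-proper u (~⇒≢ w~u) (u≢v ∘ ≡-sym)
          (~-stable λ w≁v → dominated (w , w~u , w≁v))
    ; largeDegree = λ v xs |xs|≤46 → decidable-stable (any? λ u → (u ~? v) ×-dec ¬? (u ∈? xs)) λ none →
        let k , k∉ = missing-colour (map (colour-without v) xs) (s≤s (subst (_≤ 46) (≡-sym (length-map _ xs)) |xs|≤46))
        in every-colour-blocked v k λ {w} w~v eq → k∉ (subst (_∈ map (colour-without v) xs) eq
             (∈-map⁺ (colour-without v) (decidable-stable (w ∈? xs) λ w∉ → none (w , w~v , w∉)))) }
    where open DecMembership _≟_ using (_∈?_)

  no-component : ¬ Component
  no-component K = uncolourable (component-colouring K (colour-without (Component.root K)) (colour-without-proper (Component.root K)))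

  -- Strong induction on the length: an odd closed walk with no shorter one is a `ShortestOddCycle`,
  -- which yields a forbidden `Component`.
  no-odd-closed-walk : ∀ k → NoOddClosedWalk k
  no-odd-closed-walk = <-rec NoOddClosedWalk λ k shorter odd-k w →
    no-component (CycleNeighbourhood.cycle-component G critical sunFree (shortestOddCycle triangleFree odd-k w shorter))

  impossible : ⊥
  impossible = bipartite-component no-odd-closed-walk zero no-component

theorem1p1 : {n : ℕ} (G : Graph n) → TriangleFree G → SunspotFree 4 G →
    (∀ t → 5 ≤ t → SunFree t G) → ChromaticAtMost G 47
theorem1p1 {zero} G _ _ _ = (λ ()) , λ ()
theorem1p1 {suc n} G triangleFree sunspotFree sunFree =
  decidable-stable (chromaticAtMost? G 47) (MinimalCounterexample.impossible G triangleFree sunspotFree sunFree smaller)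
  where
  smaller : ∀ v → ChromaticAtMost (delete G v) 47
  smaller v = theorem1p1 (delete G v) (λ _ _ _ → triangleFree _ _ _) (sunspotFree ∘ undelete G v) (λ t 5≤t → sunFree t 5≤t ∘ undelete G v)
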